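{- Let $f\colon\{ -1,1\}^n\times\{ -1,1\}^n\to\{ -1,1\}$ be given by $f(x,y)=\mathrm{MAJ}_n(x_1,\dots,x_n)\wedge\mathrm{MAJ}_n(y_1,\dots,y_n)$. Then $\mathrm{dns}(f)=n^{\Omega(\log n)}$.
   Context: Boolean values: $-1$ true, $+1$ false. $\mathrm{MAJ}_n(x)=1$ if $\sum x_i>0$, $-1$ otherwise. For $h\colon\{ -1,1\}^N\to\{ -1,1\}$, the threshold density $\mathrm{dns}(h)$ is the minimum $k$ such that $h(x)\equiv\mathrm{sign}\left(\sum_{i=1}^k\lambda_i\prod_{j\in S_i}x_j\right)$ for some sets $S_1,\dots,S_k\subseteq\{1,\dots,N\}$ and reals $\lambda_1,\dots,\lambda_k$.
   Formalization: In the definition of threshold density the weights λ_1,…,λ_k are taken rational instead of real; since sign-representation is finitely many strict linear inequalities in the weights, this gives the same value of dns(f). -}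

module Defs where

open import Data.Nat using (ℕ; zero; suc; _+_)
open import Data.Integer as ℤ using (ℤ)
open import Data.Fin using (Fin; zero; suc; _↑ˡ_; _↑ʳ_)
open import Data.Fin.Subset using (Subset)
open import Data.Vec using (lookup)
open import Data.Bool using (Bool; true; false; if_then_else_)
open import Data.Sign as Sign using (Sign)
open import Data.Rational as ℚ using (ℚ; 0ℚ; 1ℚ; _<_)
open import Relation.Binary.PropositionalEquality using (_≡_)
open import Relation.Nullary using (Dec; yes; no)

-- Boolean values: Sign.- is -1 = true, Sign.+ is +1 = false.
-- A point of {-1,1}^N.
Point : ℕ → Set
Point N = Fin N → Sign

BoolFun : ℕ → Set
BoolFun N = Point N → Sign

signℤ : Sign → ℤ
signℤ Sign.+ = ℤ.+ 1
signℤ Sign.- = ℤ.- (ℤ.+ 1)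

signℚ : Sign → ℚ
signℚ Sign.+ = 1ℚ
signℚ Sign.- = ℚ.- 1ℚ

sumℤ : ∀ n → (Fin n → ℤ) → ℤ
sumℤ zero    f = ℤ.0ℤ
sumℤ (suc n) f = f zero ℤ.+ sumℤ n (λ i → f (suc i))

sumℚ : ∀ n → (Fin n → ℚ) → ℚ
sumℚ zero    f = 0ℚ
sumℚ (suc n) f = f zero ℚ.+ sumℚ n (λ i → f (suc i))

prodSign : ∀ n → (Fin n → Sign) → Sign
prodSign zero    f = Sign.+
prodSign (suc n) f = f zero Sign.* prodSign n (λ i → f (suc i))

MAJ : ∀ n → BoolFun n
MAJ n x with ℤ.0ℤ ℤ.<? sumℤ n (λ i → signℤ (x i))
... | yes _ = Sign.+
... | no  _ = Sign.-

AND : Sign → Sign → Sign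
AND Sign.- Sign.- = Sign.-
AND _      _      = Sign.+

majAndMaj : ∀ n → BoolFun (n + n)
majAndMaj n z = AND (MAJ n (λ i → z (i ↑ˡ n))) (MAJ n (λ i → z (n ↑ʳ i)))

monomial : ∀ {N} → Subset N → Point N → Sign
monomial {N} S x = prodSign N (λ j → if lookup S j then x j else Sign.+)

poly : ∀ {N} k → (Fin k → Subset N) → (Fin k → ℚ) → Point N → ℚ
poly k S λs x = sumℚ k (λ i → λs i ℚ.* signℚ (monomial (S i) x))

SignRepresents : ∀ {N} → BoolFun N → (Point N → ℚ) → Set
SignRepresents {N} h p =
  ∀ (x : Point N) → (h x ≡ Sign.+ → 0ℚ < p x) × (h x ≡ Sign.- → p x < 0ℚ)
  where open import Data.Product using (_×_)

HasThresholdRep : ∀ {N} → BoolFun N → ℕ → Set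
HasThresholdRep {N} h k =
  Σ (Fin k → Subset N) λ S → Σ (Fin k → ℚ) λ λs → SignRepresents h (poly k S λs)
  where open import Data.Product using (Σ)

{-# OPTIONS --safe #-}
module Submission where

-- Degree.  Let q = 1024 and let N(z) = Π_{i<m} (z + 32 qⁱ), whose roots interlace the nodes -qʲ.
-- The weights that annihilate z, z³, …, z^(2m-1) on the nodes ±q⁰, …, ±q^m alternate in sign, as
-- do the numbers N(-qʲ); since N(qʲ) ≤ 4/3 |N(-qʲ)|, multiplying by N yields weights vⱼ > 0 with
-- |Σ vⱼ h(-qʲ)| ≤ 4/3 Σ vⱼ |h(qʲ)|, and the same with the two sides exchanged, for every polynomial
-- h of degree at most m.  If P(s, t) had degree at most m in each variable and were negative
-- exactly when s, t < 0, then n₁(s) = Σ vⱼ P(s, qʲ) and n₂(s) = Σ vⱼ P(s, -qʲ) would have a ratio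
-- close to sign s, so that n₁ + n₂ is small on the negative nodes and large on the positive ones;
-- the inequality excludes this.
--
-- Density.  Split the variables of each majority into blocks of r pairs.  One live pair of every
-- block is set to (w, w) for a logical variable w, all other pairs to (u, -u), and one averages
-- over u and over all w with a prescribed number of minus signs.  A monomial that splits an odd
-- number of pairs of a block vanishes unless it splits the live pair only; otherwise the average
-- is a polynomial whose degree is the number of such blocks.  Choosing the live pairs well, the
-- sum of r^degree over the surviving monomials is at most k, while some degree exceeds m.

open import Defs
open import Data.Bool using (Bool; true; false; if_then_else_; _xor_; _∨_)
open import Data.Empty using (⊥; ⊥-elim)
open import Data.Fin using (Fin; zero; suc; _↑ˡ_; _↑ʳ_)
open import Data.Integer hiding (suc; _≤?_; _/_)
open import Data.Integer.Properties hiding (_≤?_)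
open import Data.Integer.Tactic.RingSolver using (solve-∀)
open import Data.List as List using (List)
open import Data.Maybe as Maybe using (Maybe; just; nothing)
open import Data.Nat as ℕ using (ℕ; zero; suc)
open import Data.Nat.DivMod using (m/n*n≤m; m≡m%n+[m/n]*n; m%n<n)
open import Data.Nat.Logarithm using (⌊log₂_⌋; ⌊log₂⌋-mono-≤; ⌊log₂[2^n]⌋≡n)
open import Data.Nat.Logarithm.Core using (⌊log2⌋)
import Data.Nat.Properties as ℕ
import Data.Nat.Tactic.RingSolver as ℕ-RingSolver
open import Data.Product using (Σ; ∃; _×_; _,_; proj₁; proj₂)
open import Data.Rational as ℚ using (ℚ; 0ℚ; mkℚ; toℚᵘ)
import Data.Rational.Properties as ℚ
open import Data.Rational.Unnormalised as ℚᵘ using (mkℚᵘ; _≃_; *<*)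
import Data.Rational.Unnormalised.Properties as ℚᵘ
open import Data.Sign as Sign using (Sign)
open import Data.Sum using (_⊎_; inj₁; inj₂; [_,_]′)
open import Data.Vec using (Vec; []; _∷_; _++_; take; drop; lookup)
open import Data.Vec.Properties using (take++drop≡id; lookup-++ˡ; lookup-++ʳ)
open import Function using (_∘_)
open import Induction.WellFounded using (Acc; acc)
open import Relation.Binary.PropositionalEquality
open import Relation.Nullary using (¬_; yes; no)

open import Algebra.Properties.Semiring.Sum ℕ.+-*-semiring
  using (sum; sum-cong-≗; sum-replicate-zero; ∑-comm; *-distribˡ-sum)

-- Integer inequalities

≤-from-difference : ∀ {a b} e → b ≡ a + e → 0ℤ ≤ e → a ≤ b
≤-from-difference {a} {b} e eq 0≤e = subst₂ _≤_ (+-identityʳ a) (sym eq) (+-monoʳ-≤ a 0≤e)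

*-monoˡ-≤ : ∀ {c a b} → 0ℤ ≤ c → a ≤ b → c * a ≤ c * b
*-monoˡ-≤ {c} 0≤c = *-monoˡ-≤-nonNeg c {{nonNegative 0≤c}}

*-cancelˡ-≤ : ∀ {c a b} → 0ℤ < c → c * a ≤ c * b → a ≤ b
*-cancelˡ-≤ {c} {a} {b} 0<c = *-cancelˡ-≤-pos a b c {{positive 0<c}}

0≤+ : ∀ {a b} → 0ℤ ≤ a → 0ℤ ≤ b → 0ℤ ≤ a + b
0≤+ = +-mono-≤

0≤* : ∀ {a b} → 0ℤ ≤ a → 0ℤ ≤ b → 0ℤ ≤ a * b
0≤* {a} {b} 0≤a 0≤b = subst (_≤ a * b) (*-zeroʳ a) (*-monoˡ-≤ 0≤a 0≤b)

0<* : ∀ {a b} → 0ℤ < a → 0ℤ < b → 0ℤ < a * b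
0<* {a} {b} 0<a 0<b = subst (_< a * b) (*-zeroʳ a) (*-monoˡ-<-pos a {{positive 0<a}} 0<b)

0≤difference : ∀ {a b} → a ≤ b → 0ℤ ≤ b - a
0≤difference = i≤j⇒0≤j-i

0<difference : ∀ {a b} → a < b → 0ℤ < b - a
0<difference {a} {b} a<b = subst (_< b - a) (+-inverseʳ a) (+-monoˡ-< (- a) a<b)

0<+[_] : ∀ n → 0ℤ < +[1+ n ]
0<+[ n ] = +<+ ℕ.z<s

-- Polynomial functions

-- `Poly d f` only bounds the degree, so a constant may carry any `d`. The function is pinned down
-- up to pointwise equality, which lets `Poly-ext` rewrite it without function extensionality.
data Poly : ℕ → (ℤ → ℤ) → Set where
  constant : ∀ {d f} c → (∀ x → f x ≡ c) → Poly d f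
  horner   : ∀ {d f} c g → Poly d g → (∀ x → f x ≡ c + x * g x) → Poly (suc d) f

Poly-ext : ∀ {d f g} → (∀ x → g x ≡ f x) → Poly d f → Poly d g
Poly-ext g≗f (constant c f≗)     = constant c λ x → trans (g≗f x) (f≗ x)
Poly-ext g≗f (horner c h Ph f≗) = horner c h Ph λ x → trans (g≗f x) (f≗ x)

Poly-weaken : ∀ {d e f} → d ℕ.≤ e → Poly d f → Poly e f
Poly-weaken d≤e           (constant c f≗)    = constant c f≗
Poly-weaken (ℕ.s≤s d≤e) (horner c h Ph f≗) = horner c h (Poly-weaken d≤e Ph) f≗

Poly-+ : ∀ {d f g} → Poly d f → Poly d g → Poly d (λ x → f x + g x)
Poly-+ (constant c f≗) (constant c' g≗) = constant (c + c') λ x → cong₂ _+_ (f≗ x) (g≗ x)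
Poly-+ (constant c f≗) (horner c' k Pk g≗) =
  horner (c + c') k Pk λ x → trans (cong₂ _+_ (f≗ x) (g≗ x)) (sym (+-assoc c c' _))
Poly-+ (horner c h Ph f≗) (constant c' g≗) =
  horner (c + c') h Ph λ x → trans (cong₂ _+_ (f≗ x) (g≗ x)) (lemma c c' x (h x))
  where
  lemma : ∀ c c' x u → c + x * u + c' ≡ c + c' + x * u
  lemma = solve-∀
Poly-+ (horner c h Ph f≗) (horner c' k Pk g≗) =
  horner (c + c') _ (Poly-+ Ph Pk) λ x →
    trans (cong₂ _+_ (f≗ x) (g≗ x)) (lemma c c' x (h x) (k x))
  where
  lemma : ∀ c c' x u v → c + x * u + (c' + x * v) ≡ c + c' + x * (u + v)
  lemma = solve-∀

Poly-scale : ∀ {d f} a → Poly d f → Poly d (λ x → a * f x)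
Poly-scale a (constant c f≗) = constant (a * c) λ x → cong (a *_) (f≗ x)
Poly-scale a (horner c h Ph f≗) =
  horner (a * c) _ (Poly-scale a Ph) λ x → trans (cong (a *_) (f≗ x)) (lemma a c x (h x))
  where
  lemma : ∀ a c x u → a * (c + x * u) ≡ a * c + x * (a * u)
  lemma = solve-∀

Poly-affine : ∀ {d f} a b → Poly d f → Poly (suc d) (λ x → (a + b * x) * f x)
Poly-affine {f = f} a b Pf =
  Poly-ext (λ x → lemma a b x (f x))
    (Poly-+ (Poly-weaken (ℕ.n≤1+n _) (Poly-scale a Pf))
            (horner 0ℤ _ (Poly-scale b Pf) λ _ → refl))
  where
  lemma : ∀ a b x u → (a + b * x) * u ≡ a * u + (0ℤ + x * (b * u))
  lemma = solve-∀

Poly-∘-affine : ∀ {d f} a b → Poly d f → Poly d (λ x → f (a + b * x))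
Poly-∘-affine a b (constant c f≗) = constant c λ _ → f≗ _
Poly-∘-affine a b (horner c h Ph f≗) =
  Poly-ext (λ x → f≗ (a + b * x))
    (Poly-+ (constant c λ _ → refl) (Poly-affine a b (Poly-∘-affine a b Ph)))

Poly-pred : ∀ {d f} → Poly d f → Poly d (λ x → f (x - 1ℤ))
Poly-pred {f = f} Pf = Poly-ext (λ x → cong f (lemma x)) (Poly-∘-affine -1ℤ 1ℤ Pf)
  where
  lemma : ∀ x → x - 1ℤ ≡ -1ℤ + 1ℤ * x
  lemma = solve-∀

Poly-neg-arg : ∀ {d f} → Poly d f → Poly d (λ x → f (- x))
Poly-neg-arg {f = f} Pf = Poly-ext (λ x → cong f (lemma x)) (Poly-∘-affine 0ℤ -1ℤ Pf)
  where
  lemma : ∀ x → - x ≡ 0ℤ + -1ℤ * x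
  lemma = solve-∀

-- The leading terms cancel, so that the degree does not grow.
Poly-average : ∀ {d f} a → Poly d f → Poly d (λ x → (a - x) * f x + x * f (x - 1ℤ))
Poly-average a (constant c f≗) =
  constant (a * c) λ x →
    trans (cong₂ (λ u v → (a - x) * u + x * v) (f≗ x) (f≗ (x - 1ℤ))) (lemma a c x)
  where
  lemma : ∀ a c x → (a - x) * c + x * c ≡ a * c
  lemma = solve-∀
Poly-average a (horner c h Ph f≗) =
  horner (a * c) _ (Poly-+ (Poly-average a Ph) (Poly-scale -1ℤ (Poly-pred Ph))) λ x →
    trans (cong₂ (λ u v → (a - x) * u + x * v) (f≗ x) (f≗ (x - 1ℤ)))
          (lemma a c x (h x) (h (x - 1ℤ)))
  where
  lemma : ∀ a c x u v → (a - x) * (c + x * u) + x * (c + (x - 1ℤ) * v) ≡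
                        a * c + x * ((a - x) * u + x * v + -1ℤ * v)
  lemma = solve-∀

Poly-sumℤ : ∀ {d} k (f : Fin k → ℤ → ℤ) → (∀ i → Poly d (f i)) → Poly d (λ x → sumℤ k (λ i → f i x))
Poly-sumℤ zero    f Pf = constant 0ℤ λ _ → refl
Poly-sumℤ (suc k) f Pf = Poly-+ (Pf zero) (Poly-sumℤ k (f ∘ suc) (Pf ∘ suc))

-- Positive functionals on geometric nodes

-- Π_{k<m} (E + w k) g evaluated at 0, where E is the shift (E g) j = g (j + 1).
functional : (ℕ → ℤ) → ℕ → (ℕ → ℤ) → ℤ
functional w zero    g = g 0
functional w (suc m) g = functional w m (g ∘ suc) + w m * functional w m g

functional-cong : ∀ w m {f g} → (∀ j → j ℕ.≤ m → f j ≡ g j) → functional w m f ≡ functional w m g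
functional-cong w zero    f≗g = f≗g 0 ℕ.z≤n
functional-cong w (suc m) f≗g =
  cong₂ (λ u v → u + w m * v)
    (functional-cong w m λ j j≤m → f≗g (suc j) (ℕ.s≤s j≤m))
    (functional-cong w m λ j j≤m → f≗g j (ℕ.m≤n⇒m≤1+n j≤m))

functional-+ : ∀ w m f g → functional w m (λ j → f j + g j) ≡ functional w m f + functional w m g
functional-+ w zero    f g = refl
functional-+ w (suc m) f g
  rewrite functional-+ w m (f ∘ suc) (g ∘ suc) | functional-+ w m f g =
  lemma (w m) (functional w m (f ∘ suc)) (functional w m (g ∘ suc)) (functional w m f) (functional w m g)
  where
  lemma : ∀ c a b a' b' → a + b + c * (a' + b') ≡ a + c * a' + (b + c * b')
  lemma = solve-∀

functional-* : ∀ w m c f → functional w m (λ j → c * f j) ≡ c * functional w m f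
functional-* w zero    c f = refl
functional-* w (suc m) c f
  rewrite functional-* w m c (f ∘ suc) | functional-* w m c f =
  lemma (w m) c (functional w m (f ∘ suc)) (functional w m f)
  where
  lemma : ∀ v c a b → c * a + v * (c * b) ≡ c * (a + v * b)
  lemma = solve-∀

functional-mono : ∀ w m {f g} → (∀ k → 0ℤ ≤ w k) → (∀ j → j ℕ.≤ m → f j ≤ g j) →
                  functional w m f ≤ functional w m g
functional-mono w zero    0≤w f≤g = f≤g 0 ℕ.z≤n
functional-mono w (suc m) 0≤w f≤g =
  +-mono-≤ (functional-mono w m 0≤w λ j j≤m → f≤g (suc j) (ℕ.s≤s j≤m))
           (*-monoˡ-≤ (0≤w m) (functional-mono w m 0≤w λ j j≤m → f≤g j (ℕ.m≤n⇒m≤1+n j≤m)))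

-- The pure shift `E^m` has coefficient 1 in the product, so strictness survives even if every `w k`
-- is zero.
functional-positive : ∀ w m {f} → (∀ k → 0ℤ ≤ w k) → (∀ j → j ℕ.≤ m → 0ℤ < f j) → 0ℤ < functional w m f
functional-positive w zero    0≤w 0<f = 0<f 0 ℕ.z≤n
functional-positive w (suc m) 0≤w 0<f =
  +-mono-<-≤ (functional-positive w m 0≤w λ j j≤m → 0<f (suc j) (ℕ.s≤s j≤m))
             (0≤* (0≤w m) (<⇒≤ (functional-positive w m 0≤w λ j j≤m → 0<f j (ℕ.m≤n⇒m≤1+n j≤m))))

Poly-functional : ∀ {d} w m (f : ℕ → ℤ → ℤ) → (∀ j → Poly d (f j)) →
                  Poly d (λ x → functional w m (λ j → f j x))
Poly-functional w zero    f Pf = Pf 0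
Poly-functional w (suc m) f Pf =
  Poly-+ (Poly-functional w m (f ∘ suc) (Pf ∘ suc)) (Poly-scale (w m) (Poly-functional w m f Pf))

-- Alternating functionals and odd parts

alt : ℕ → ℤ
alt j = -1ℤ ^ j

alt*alt : ∀ j → alt j * alt j ≡ 1ℤ
alt*alt zero    = refl
alt*alt (suc j) = trans (lemma (alt j)) (alt*alt j)
  where
  lemma : ∀ a → -1ℤ * a * (-1ℤ * a) ≡ a * a
  lemma = solve-∀

-- Conjugation by `alt` turns the shift `E` into `-E`, hence each factor `E - w k` into
-- `-(E + w k)`; the m signs collect in `alt m`.
functional-alt : ∀ w m f → functional (-_ ∘ w) m f ≡ alt m * functional w m (λ j → alt j * f j)
functional-alt w zero    f = sym (trans (*-identityˡ _) (*-identityˡ _))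
functional-alt w (suc m) f
  rewrite functional-alt w m (f ∘ suc) | functional-alt w m f
        | functional-cong w m {λ j → alt (suc j) * f (suc j)} {λ j → -1ℤ * (alt j * f (suc j))}
            (λ j _ → *-assoc -1ℤ (alt j) (f (suc j)))
        | functional-* w m -1ℤ (λ j → alt j * f (suc j)) =
  lemma (alt m) (w m) (functional w m (λ j → alt j * f (suc j))) (functional w m (λ j → alt j * f j))
  where
  lemma : ∀ s v a b → s * a + (- v) * (s * b) ≡ -1ℤ * s * (-1ℤ * a + v * b)
  lemma = solve-∀

functional-zero : ∀ w m {f} → (∀ j → f j ≡ 0ℤ) → functional w m f ≡ 0ℤ
functional-zero w m {f} f≗0 =
  trans (functional-cong w m {f} {λ j → 0ℤ * 0ℤ} (λ j _ → f≗0 j)) (functional-* w m 0ℤ (λ _ → 0ℤ))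

-- On a geometric sequence of ratio `x` the shift is multiplication by `x`, so the factor with index
-- `k` is `x - x = 0`, wherever it stands in the product.
functional-geometric : ∀ w c x {k m} → k ℕ.< m → w k ≡ - x → functional w m (λ j → c * x ^ j) ≡ 0ℤ
functional-geometric w c x {k} {suc m} (ℕ.s≤s k≤m) wk =
  trans (cong (_+ w m * functional w m (λ j → c * x ^ j))
          (trans (functional-cong w m (λ j _ → lemma c x (x ^ j))) (functional-* w m x (λ j → c * x ^ j))))
        (case (ℕ.m≤n⇒m<n∨m≡n k≤m))
  where
  G = functional w m (λ j → c * x ^ j)
  lemma : ∀ c x u → c * (x * u) ≡ x * (c * u)
  lemma = solve-∀
  lemma₂ : ∀ x g → x * g + - x * g ≡ 0ℤ
  lemma₂ = solve-∀
  case : (k ℕ.< m) ⊎ (k ≡ m) → x * G + w m * G ≡ 0ℤ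
  case (inj₁ k<m) rewrite functional-geometric w c x k<m wk = cong₂ _+_ (*-zeroʳ x) (*-zeroʳ (w m))
  case (inj₂ refl) rewrite wk = lemma₂ x G

-- `B` is the square root of `q`, which puts each root midway between two nodes on the logarithmic
-- scale. Later arguments see only the facts listed here: `16B+1≤q` serves the factors with roots
-- below a node, `15q+B+1≤qB` those with roots above it.
opaque
  q B : ℤ
  q = + 1024
  B = + 32

  q≡1024 : q ≡ + 1024
  q≡1024 = refl

  0<q : 0ℤ < q
  0<q = 0<+[ 1023 ]

  0<B : 0ℤ < B
  0<B = 0<+[ 31 ]

  1≤B : 1ℤ ≤ B
  1≤B = +≤+ (ℕ.s≤s ℕ.z≤n)

  16B+1≤q : + 16 * B + 1ℤ ≤ q
  16B+1≤q = ≤-from-difference (+ 511) refl (+≤+ ℕ.z≤n)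

  15q+B+1≤qB : + 15 * q + B + 1ℤ ≤ q * B
  15q+B+1≤qB = ≤-from-difference (+ 17375) refl (+≤+ ℕ.z≤n)

0<q^ : ∀ j → 0ℤ < q ^ j
0<q^ zero    = 0<+[ 0 ]
0<q^ (suc j) = 0<* 0<q (0<q^ j)

1≤q^ : ∀ j → 1ℤ ≤ q ^ j
1≤q^ j = i<j⇒suc[i]≤j (0<q^ j)

q^-mono : ∀ {i j} → i ℕ.≤ j → q ^ i ≤ q ^ j
q^-mono {j = j} ℕ.z≤n = 1≤q^ j
q^-mono (ℕ.s≤s i≤j)   = *-monoˡ-≤ (<⇒≤ 0<q) (q^-mono i≤j)

-- The ratio of the sequence j ↦ (qʲ)^(2k+1): subtracting these weights annihilates the odd powers
-- up to 2m-1.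
weight : ℕ → ℤ
weight k = q ^ suc (k ℕ.+ k)

0≤weight : ∀ k → 0ℤ ≤ weight k
0≤weight k = <⇒≤ (0<q^ (suc (k ℕ.+ k)))

neg-^ : ∀ i → (∃ λ k → i ≡ k ℕ.+ k × ∀ x → (- x) ^ i ≡ x ^ i) ⊎
              (∃ λ k → i ≡ suc (k ℕ.+ k) × ∀ x → (- x) ^ i ≡ - (x ^ i))
neg-^ zero = inj₁ (0 , refl , λ _ → refl)
neg-^ (suc i) with neg-^ i
... | inj₁ (k , refl , eq) = inj₂ (k , refl , λ x → trans (cong (- x *_) (eq x)) (lemma x (x ^ i)))
  where
  lemma : ∀ x u → - x * u ≡ - (x * u)
  lemma = solve-∀
... | inj₂ (k , refl , eq) =
  inj₁ (suc k , cong suc (sym (ℕ.+-suc k k)) , λ x → trans (cong (- x *_) (eq x)) (lemma x (x ^ i)))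
  where
  lemma : ∀ x u → - x * - u ≡ x * u
  lemma = solve-∀

^-swap : ∀ (x : ℤ) i j → (x ^ j) ^ i ≡ (x ^ i) ^ j
^-swap x i j = trans (^-*-assoc x j i) (trans (cong (x ^_) (ℕ.*-comm j i)) (sym (^-*-assoc x i j)))

double-cancel-< : ∀ {k m} → k ℕ.+ k ℕ.< m ℕ.+ m → k ℕ.< m
double-cancel-< {k} {m} 2k<2m with k ℕ.<? m
... | yes k<m = k<m
... | no  k≮m = ⊥-elim (ℕ.<⇒≱ 2k<2m (ℕ.+-mono-≤ (ℕ.≮⇒≥ k≮m) (ℕ.≮⇒≥ k≮m)))

functional-odd-part-monomial : ∀ m c i → i ℕ.≤ m ℕ.+ m →
  functional (-_ ∘ weight) m (λ j → (q ^ j) ^ i * c - (- (q ^ j)) ^ i * c) ≡ 0ℤ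
functional-odd-part-monomial m c i i≤2m with neg-^ i
... | inj₁ (k , _ , eq) = functional-zero (-_ ∘ weight) m λ j →
  trans (cong (λ u → (q ^ j) ^ i * c - u * c) (eq (q ^ j))) (+-inverseʳ ((q ^ j) ^ i * c))
... | inj₂ (k , refl , eq) =
  trans (functional-cong (-_ ∘ weight) m λ j _ →
          trans (cong (λ u → (q ^ j) ^ i * c - u * c) (eq (q ^ j)))
                (trans (lemma c ((q ^ j) ^ i)) (cong ((c + c) *_) (^-swap q i j))))
        (functional-geometric (-_ ∘ weight) (c + c) (q ^ i) (double-cancel-< {k} {m} i≤2m) refl)
  where
  lemma : ∀ c u → u * c - (- u) * c ≡ (c + c) * u
  lemma = solve-∀

-- The exponent `i` is an accumulator: a Horner step moves one factor z from the polynomial into zⁱ,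
-- so `i` plus the degree bound stays constant. Even powers cancel pointwise, odd ones are geometric
-- in j.
functional-odd-part : ∀ m {d f} → Poly d f → ∀ i → i ℕ.+ d ℕ.≤ m ℕ.+ m →
  functional (-_ ∘ weight) m (λ j → (q ^ j) ^ i * f (q ^ j) - (- (q ^ j)) ^ i * f (- (q ^ j))) ≡ 0ℤ
functional-odd-part m (constant c f≗) i i+d≤2m =
  trans (functional-cong (-_ ∘ weight) m λ j _ →
          cong₂ (λ u v → (q ^ j) ^ i * u - (- (q ^ j)) ^ i * v) (f≗ (q ^ j)) (f≗ (- (q ^ j))))
        (functional-odd-part-monomial m c i (ℕ.≤-trans (ℕ.m≤m+n i _) i+d≤2m))
functional-odd-part m {suc d} (horner c g Pg f≗) i i+d≤2m =
  trans (functional-cong (-_ ∘ weight) m λ j _ →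
          trans (cong₂ (λ u v → (q ^ j) ^ i * u - (- (q ^ j)) ^ i * v) (f≗ (q ^ j)) (f≗ (- (q ^ j))))
                (lemma c (q ^ j) ((q ^ j) ^ i) ((- (q ^ j)) ^ i) (g (q ^ j)) (g (- (q ^ j)))))
  (trans (functional-+ (-_ ∘ weight) m _ _)
         (cong₂ _+_ (functional-odd-part-monomial m c i (ℕ.≤-trans (ℕ.m≤m+n i _) i+d≤2m))
                    (functional-odd-part m Pg (suc i) (subst (ℕ._≤ m ℕ.+ m) (ℕ.+-suc i d) i+d≤2m))))
  where
  lemma : ∀ c y u v a b → u * (c + y * a) - v * (c + - y * b) ≡
                          (u * c - v * c) + (y * u * a - - y * v * b)
  lemma = solve-∀

-- The roots -B qⁱ interlace the nodes -qʲ, and stay far from them on the logarithmic scale.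
node-poly : ℕ → ℤ → ℤ
node-poly zero    z = 1ℤ
node-poly (suc m) z = (B * q ^ m + 1ℤ * z) * node-poly m z

Poly-node-poly-* : ∀ m {d h} → Poly d h → Poly (m ℕ.+ d) (λ z → node-poly m z * h z)
Poly-node-poly-* zero    {h = h} Ph = Poly-ext (λ z → *-identityˡ (h z)) Ph
Poly-node-poly-* (suc m) {h = h} Ph =
  Poly-ext (λ z → *-assoc (B * q ^ m + 1ℤ * z) (node-poly m z) (h z))
           (Poly-affine (B * q ^ m) 1ℤ (Poly-node-poly-* m Ph))

0<node-poly : ∀ m {z} → 0ℤ < z → 0ℤ < node-poly m z
0<node-poly zero    0<z = 0<+[ 0 ]
0<node-poly (suc m) {z} 0<z =
  0<* (+-mono-< (0<* 0<B (0<q^ m)) (0<* {1ℤ} 0<+[ 0 ] 0<z)) (0<node-poly m 0<z)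

-- Here X = qⁱ, Y = qʲ, and the new factor multiplies the ratio A/C by (Y - BX)/(Y + BX). Letting
-- the loss X/(8Y) grow by the factor q leaves the slack (q - 16B - 1)XY + B(1 + q)X².
below-step : ∀ X Y A C → 0ℤ ≤ X → q * X ≤ Y → 0ℤ ≤ C →
  (+ 8 * Y - X) * C ≤ + 8 * Y * A →
  (+ 8 * Y - q * X) * ((B * X + 1ℤ * Y) * C) ≤ + 8 * Y * (-1ℤ * (B * X + 1ℤ * (- Y)) * A)
below-step X Y A C 0≤X qX≤Y 0≤C hyp = begin
  (+ 8 * Y - q * X) * ((B * X + 1ℤ * Y) * C)
    ≤⟨ ≤-from-difference _ (lemma₁ q B X Y C)
        (0≤* (0≤+ (0≤* (0≤difference 16B+1≤q) (0≤* 0≤X 0≤Y))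
                  (0≤* (0≤* (<⇒≤ 0<B) (0≤+ (+≤+ ℕ.z≤n) (<⇒≤ 0<q))) (0≤* 0≤X 0≤X))) 0≤C) ⟩
  (Y - B * X) * ((+ 8 * Y - X) * C)
    ≤⟨ *-monoˡ-≤ 0≤Y-BX hyp ⟩
  (Y - B * X) * (+ 8 * Y * A)
    ≡⟨ lemma₂ B X Y A ⟩
  + 8 * Y * (-1ℤ * (B * X + 1ℤ * (- Y)) * A) ∎
  where
  open ≤-Reasoning
  0≤Y : 0ℤ ≤ Y
  0≤Y = ≤-trans (0≤* (<⇒≤ 0<q) 0≤X) qX≤Y
  lemma₀ : ∀ q B X Y → Y - B * X ≡ (Y - q * X) + ((q - (+ 16 * B + 1ℤ)) + (+ 15 * B + 1ℤ)) * X
  lemma₀ = solve-∀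
  0≤Y-BX : 0ℤ ≤ Y - B * X
  0≤Y-BX = subst (0ℤ ≤_) (sym (lemma₀ q B X Y))
    (0≤+ (0≤difference qX≤Y)
         (0≤* (0≤+ (0≤difference 16B+1≤q) (0≤+ (0≤* {+ 15} (+≤+ ℕ.z≤n) (<⇒≤ 0<B)) (+≤+ ℕ.z≤n))) 0≤X))
  lemma₁ : ∀ q B X Y C → (Y - B * X) * ((+ 8 * Y - X) * C) ≡
    (+ 8 * Y - q * X) * ((B * X + 1ℤ * Y) * C) +
    ((q - (+ 16 * B + 1ℤ)) * (X * Y) + B * (1ℤ + q) * (X * X)) * C
  lemma₁ = solve-∀
  lemma₂ : ∀ B X Y A → (Y - B * X) * (+ 8 * Y * A) ≡ + 8 * Y * (-1ℤ * (B * X + 1ℤ * (- Y)) * A)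
  lemma₂ = solve-∀

-- |N(-qʲ)| / N(qʲ) ≥ 1 - q^(i-j) / 8: the losses of the successive factors grow geometrically.
node-ratio-below : ∀ {i j} → i ℕ.≤ j →
  (+ 8 * q ^ j - q ^ i) * node-poly i (q ^ j) ≤ + 8 * q ^ j * (alt i * node-poly i (- (q ^ j)))
node-ratio-below {zero} {j} _ =
  ≤-from-difference 1ℤ (lemma (q ^ j)) (+≤+ ℕ.z≤n)
  where
  lemma : ∀ Y → + 8 * Y * (1ℤ * 1ℤ) ≡ (+ 8 * Y - 1ℤ) * 1ℤ + 1ℤ
  lemma = solve-∀
node-ratio-below {suc i} {j} i<j =
  subst ((+ 8 * q ^ j - q ^ suc i) * node-poly (suc i) (q ^ j) ≤_)
    (cong (+ 8 * q ^ j *_) (lemma (alt i) (B * q ^ i + 1ℤ * (- (q ^ j))) (node-poly i (- (q ^ j)))))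
    (below-step (q ^ i) (q ^ j) (alt i * node-poly i (- (q ^ j))) (node-poly i (q ^ j))
      (<⇒≤ (0<q^ i)) (q^-mono i<j) (<⇒≤ (0<node-poly i (0<q^ j))) (node-ratio-below (ℕ.<⇒≤ i<j)))
  where
  lemma : ∀ s u a → -1ℤ * u * (s * a) ≡ -1ℤ * s * (u * a)
  lemma = solve-∀

-- Here X = q^r, Y = qʲ, and the new root -BXY lies beyond the node -Y, so the ratio is multiplied
-- by (BX - 1)/(BX + 1). The slack is linear in X; expanded around X = 1, both of its coefficients
-- are nonnegative.
above-step : ∀ X Y A C → 1ℤ ≤ X → 0ℤ ≤ Y → 0ℤ ≤ C →
  + 7 * (+ 7 * X + 1ℤ) * C ≤ + 64 * X * A →
  + 7 * (+ 7 * (q * X) + 1ℤ) * ((B * (X * Y) + 1ℤ * Y) * C) ≤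
  + 64 * (q * X) * ((B * (X * Y) + 1ℤ * (- Y)) * A)
above-step X Y A C 1≤X 0≤Y 0≤C hyp = begin
  + 7 * (+ 7 * (q * X) + 1ℤ) * ((B * (X * Y) + 1ℤ * Y) * C)
    ≤⟨ ≤-from-difference _ (lemma₁ q B X Y C)
         (0≤* {+ 7} (+≤+ ℕ.z≤n) (0≤* (0≤* (0≤+ (0≤* 0≤qB-14q-B 0≤X-1) 0≤qB-15q-B-1) 0≤Y) 0≤C)) ⟩
  q * Y * (B * X - 1ℤ) * (+ 7 * (+ 7 * X + 1ℤ) * C)
    ≤⟨ *-monoˡ-≤ (0≤* (0≤* (<⇒≤ 0<q) 0≤Y) 0≤BX-1) hyp ⟩
  q * Y * (B * X - 1ℤ) * (+ 64 * X * A)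
    ≡⟨ lemma₂ q B X Y A ⟩
  + 64 * (q * X) * ((B * (X * Y) + 1ℤ * (- Y)) * A) ∎
  where
  open ≤-Reasoning
  0≤X-1 : 0ℤ ≤ X - 1ℤ
  0≤X-1 = 0≤difference 1≤X
  0≤qB-15q-B-1 : 0ℤ ≤ q * B - (+ 15 * q + B + 1ℤ)
  0≤qB-15q-B-1 = 0≤difference 15q+B+1≤qB
  0≤qB-14q-B : 0ℤ ≤ q * B - (+ 15 * q + B + 1ℤ) + (q + 1ℤ)
  0≤qB-14q-B = 0≤+ 0≤qB-15q-B-1 (0≤+ (<⇒≤ 0<q) (+≤+ ℕ.z≤n))
  lemma₀ : ∀ B X → B * X - 1ℤ ≡ B * (X - 1ℤ) + (B - 1ℤ)
  lemma₀ = solve-∀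
  0≤BX-1 : 0ℤ ≤ B * X - 1ℤ
  0≤BX-1 = subst (0ℤ ≤_) (sym (lemma₀ B X)) (0≤+ (0≤* (<⇒≤ 0<B) 0≤X-1) (0≤difference 1≤B))
  lemma₁ : ∀ q B X Y C → q * Y * (B * X - 1ℤ) * (+ 7 * (+ 7 * X + 1ℤ) * C) ≡
    + 7 * (+ 7 * (q * X) + 1ℤ) * ((B * (X * Y) + 1ℤ * Y) * C) +
    + 7 * (((q * B - (+ 15 * q + B + 1ℤ) + (q + 1ℤ)) * (X - 1ℤ) + (q * B - (+ 15 * q + B + 1ℤ))) * Y * C)
  lemma₁ = solve-∀
  lemma₂ : ∀ q B X Y A → q * Y * (B * X - 1ℤ) * (+ 64 * X * A) ≡
    + 64 * (q * X) * ((B * (X * Y) + 1ℤ * (- Y)) * A)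
  lemma₂ = solve-∀

-- |N(-qʲ)| / N(qʲ) ≥ 7/8 (7/8 + q^(-r) / 8), the first 7/8 coming from the factors below the node.
node-ratio-above : ∀ r j →
  + 7 * (+ 7 * q ^ r + 1ℤ) * node-poly (r ℕ.+ j) (q ^ j) ≤
  + 64 * q ^ r * (alt j * node-poly (r ℕ.+ j) (- (q ^ j)))
node-ratio-above zero j =
  subst₂ _≤_ (lemma₂ C) (lemma₃ A)
    (*-monoˡ-≤ {+ 8} (+≤+ ℕ.z≤n)
      (*-cancelˡ-≤ (0<q^ j) (subst₂ _≤_ (lemma₀ (q ^ j) C) (lemma₁ (q ^ j) A) (node-ratio-below (ℕ.≤-refl {j})))))
  where
  C = node-poly j (q ^ j)
  A = alt j * node-poly j (- (q ^ j))
  lemma₀ : ∀ Y C → (+ 8 * Y - Y) * C ≡ Y * (+ 7 * C)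
  lemma₀ = solve-∀
  lemma₁ : ∀ Y A → + 8 * Y * A ≡ Y * (+ 8 * A)
  lemma₁ = solve-∀
  lemma₂ : ∀ C → + 8 * (+ 7 * C) ≡ + 7 * (+ 7 * 1ℤ + 1ℤ) * C
  lemma₂ = solve-∀
  lemma₃ : ∀ A → + 8 * (+ 8 * A) ≡ + 64 * 1ℤ * A
  lemma₃ = solve-∀
node-ratio-above (suc r) j =
  subst₂ _≤_
    (cong (λ t → + 7 * (+ 7 * (q * q ^ r) + 1ℤ) * ((B * t + 1ℤ * q ^ j) * node-poly (r ℕ.+ j) (q ^ j)))
      (sym (^-distribˡ-+-* q r j)))
    (cong (+ 64 * (q * q ^ r) *_)
      (trans (cong (λ t → (B * t + 1ℤ * (- (q ^ j))) * (alt j * node-poly (r ℕ.+ j) (- (q ^ j))))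
               (sym (^-distribˡ-+-* q r j)))
             (lemma (B * q ^ (r ℕ.+ j) + 1ℤ * (- (q ^ j))) (alt j) (node-poly (r ℕ.+ j) (- (q ^ j))))))
    (above-step (q ^ r) (q ^ j) (alt j * node-poly (r ℕ.+ j) (- (q ^ j))) (node-poly (r ℕ.+ j) (q ^ j))
      (1≤q^ r) (<⇒≤ (0<q^ j)) (<⇒≤ (0<node-poly (r ℕ.+ j) (0<q^ j))) (node-ratio-above r j))
  where
  lemma : ∀ u s a → u * (s * a) ≡ s * (u * a)
  lemma = solve-∀

-- For j ≤ m exactly j factors of N(-qʲ) are negative, so `M⁻` is its absolute value.
M⁺ M⁻ : ℕ → ℕ → ℤ
M⁺ m j = node-poly m (q ^ j)
M⁻ m j = alt j * node-poly m (- (q ^ j))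

0<M⁺ : ∀ m j → 0ℤ < M⁺ m j
0<M⁺ m j = 0<node-poly m (0<q^ j)

-- The ratio bounded in `node-ratio-above` exceeds 49/64, hence 48/64 = 3/4.
3M⁺≤4M⁻ : ∀ {m j} → j ℕ.≤ m → + 3 * M⁺ m j ≤ + 4 * M⁻ m j
3M⁺≤4M⁻ {m} {j} j≤m with m ℕ.∸ j | ℕ.m∸n+n≡m j≤m
... | r | refl =
  *-cancelˡ-≤ {+ 16 * q ^ r} (0<* {+ 16} 0<+[ 15 ] (0<q^ r)) (begin
    + 16 * q ^ r * (+ 3 * M⁺ m j)
      ≤⟨ ≤-from-difference _ (lemma (q ^ r) (M⁺ m j))
           (0≤+ (0≤* {q ^ r} (<⇒≤ (0<q^ r)) (<⇒≤ (0<M⁺ m j))) (0≤* {+ 7} (+≤+ ℕ.z≤n) (<⇒≤ (0<M⁺ m j)))) ⟩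
    + 7 * (+ 7 * q ^ r + 1ℤ) * M⁺ m j
      ≤⟨ node-ratio-above r j ⟩
    + 64 * q ^ r * M⁻ m j
      ≡⟨ lemma₂ (q ^ r) (M⁻ m j) ⟩
    + 16 * q ^ r * (+ 4 * M⁻ m j) ∎)
  where
  open ≤-Reasoning
  lemma : ∀ X C → + 7 * (+ 7 * X + 1ℤ) * C ≡ + 16 * X * (+ 3 * C) + (X * C + + 7 * C)
  lemma = solve-∀
  lemma₂ : ∀ X A → + 64 * X * A ≡ + 16 * X * (+ 4 * A)
  lemma₂ = solve-∀

0<M⁻ : ∀ {m j} → j ℕ.≤ m → 0ℤ < M⁻ m j
0<M⁻ {m} {j} j≤m =
  *-cancelˡ-<-nonNeg {0ℤ} {M⁻ m j} (+ 4) (<-≤-trans (0<* {+ 3} 0<+[ 2 ] (0<M⁺ m j)) (3M⁺≤4M⁻ j≤m))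

alt-cases : ∀ j → alt j ≡ 1ℤ ⊎ alt j ≡ -1ℤ
alt-cases zero = inj₁ refl
alt-cases (suc j) with alt-cases j
... | inj₁ eq = inj₂ (cong (-1ℤ *_) eq)
... | inj₂ eq = inj₁ (cong (-1ℤ *_) eq)

alt-*-≤ : ∀ j {h g} → - g ≤ h → h ≤ g → alt j * h ≤ g
alt-*-≤ j {h} {g} -g≤h h≤g with alt-cases j
... | inj₁ eq rewrite eq = subst (_≤ g) (sym (*-identityˡ h)) h≤g
... | inj₂ eq rewrite eq = subst₂ _≤_ (sym (-1*i≡-i h)) (neg-involutive g) (neg-mono-≤ -g≤h)

-- Comparison of values at mirrored nodes

positive-functional : ℕ → (ℕ → ℤ) → ℤ
positive-functional = functional weight

-- The product N h has degree at most 2m, so the alternating functional annihilates its odd part.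
-- Passing to the positive functional multiplies each term by `alt j`, which `M⁻` absorbs at the
-- negative nodes.
reflection : ∀ {m h} → Poly m h →
  positive-functional m (λ j → alt j * (M⁺ m j * h (q ^ j))) ≡
  positive-functional m (λ j → M⁻ m j * h (- (q ^ j)))
reflection {m} {h} Ph = i-j≡0⇒i≡j _ _ (begin
  Ψ a - Ψ b                        ≡⟨ cong (λ u → Ψ a + u) (-1*i≡-i (Ψ b)) ⟨
  Ψ a + -1ℤ * Ψ b                  ≡⟨ cong (λ u → Ψ a + u) (functional-* weight m -1ℤ b) ⟨
  Ψ a + Ψ (λ j → -1ℤ * b j)        ≡⟨ functional-+ weight m a (λ j → -1ℤ * b j) ⟨
  Ψ (λ j → a j + -1ℤ * b j)        ≡⟨ functional-cong weight m (λ j _ →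
                                        lemma (alt j) (M⁺ m j) (N- j) (h (q ^ j)) (h (- (q ^ j)))) ⟩
  E                                ≡⟨ *-identityˡ E ⟨
  1ℤ * E                           ≡⟨ cong (_* E) (alt*alt m) ⟨
  alt m * alt m * E                ≡⟨ *-assoc (alt m) (alt m) E ⟩
  alt m * (alt m * E)              ≡⟨ cong (alt m *_) (functional-alt weight m c) ⟨
  alt m * functional (-_ ∘ weight) m c
    ≡⟨ cong (alt m *_) (functional-odd-part m (Poly-node-poly-* m Ph) 0 ℕ.≤-refl) ⟩
  alt m * 0ℤ                       ≡⟨ *-zeroʳ (alt m) ⟩
  0ℤ                               ∎)
  where
  open ≡-Reasoning
  Ψ = positive-functional m
  N- : ℕ → ℤ
  N- j = node-poly m (- (q ^ j))
  a b c : ℕ → ℤ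
  a j = alt j * (M⁺ m j * h (q ^ j))
  b j = M⁻ m j * h (- (q ^ j))
  c j = 1ℤ * (node-poly m (q ^ j) * h (q ^ j)) - 1ℤ * (N- j * h (- (q ^ j)))
  E = Ψ (λ j → alt j * c j)
  lemma : ∀ s n n' u v → s * (n * u) + -1ℤ * (s * n' * v) ≡ s * (1ℤ * (n * u) - 1ℤ * (n' * v))
  lemma = solve-∀

-- After `reflection` the sum runs over the positive nodes with alternating signs. A bound on the
-- absolute value of `h` is insensitive to these signs, and `3M⁺≤4M⁻` exchanges the weights.
reflection-bound : ∀ {m h} (g : ℕ → ℤ) → Poly m h →
  (∀ j → j ℕ.≤ m → 0ℤ ≤ g j) → (∀ j → j ℕ.≤ m → - g j ≤ h (q ^ j)) → (∀ j → j ℕ.≤ m → h (q ^ j) ≤ g j) →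
  + 3 * positive-functional m (λ j → M⁻ m j * h (- (q ^ j))) ≤
  + 4 * positive-functional m (λ j → M⁻ m j * g j)
reflection-bound {m} {h} g Ph 0≤g lower upper = begin
  + 3 * positive-functional m (λ j → M⁻ m j * h (- (q ^ j)))
    ≡⟨ cong (+ 3 *_) (reflection Ph) ⟨
  + 3 * positive-functional m (λ j → alt j * (M⁺ m j * h (q ^ j)))
    ≡⟨ functional-* weight m (+ 3) (λ j → alt j * (M⁺ m j * h (q ^ j))) ⟨
  positive-functional m (λ j → + 3 * (alt j * (M⁺ m j * h (q ^ j))))
    ≤⟨ functional-mono weight m 0≤weight pointwise ⟩
  positive-functional m (λ j → + 4 * (M⁻ m j * g j))
    ≡⟨ functional-* weight m (+ 4) (λ j → M⁻ m j * g j) ⟩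
  + 4 * positive-functional m (λ j → M⁻ m j * g j) ∎
  where
  open ≤-Reasoning
  lemma₁ : ∀ s n u → + 3 * (s * (n * u)) ≡ + 3 * n * (s * u)
  lemma₁ = solve-∀
  lemma₂ : ∀ n u → + 3 * n * u ≡ u * (+ 3 * n)
  lemma₂ = solve-∀
  lemma₃ : ∀ n u → u * (+ 4 * n) ≡ + 4 * (n * u)
  lemma₃ = solve-∀
  pointwise : ∀ j → j ℕ.≤ m → + 3 * (alt j * (M⁺ m j * h (q ^ j))) ≤ + 4 * (M⁻ m j * g j)
  pointwise j j≤m = begin
    + 3 * (alt j * (M⁺ m j * h (q ^ j)))  ≡⟨ lemma₁ (alt j) (M⁺ m j) (h (q ^ j)) ⟩
    + 3 * M⁺ m j * (alt j * h (q ^ j))    ≤⟨ *-monoˡ-≤ (0≤* {+ 3} (+≤+ ℕ.z≤n) (<⇒≤ (0<M⁺ m j)))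
                                               (alt-*-≤ j (lower j j≤m) (upper j j≤m)) ⟩
    + 3 * M⁺ m j * g j                    ≡⟨ lemma₂ (M⁺ m j) (g j) ⟩
    g j * (+ 3 * M⁺ m j)                  ≤⟨ *-monoˡ-≤ (0≤g j j≤m) (3M⁺≤4M⁻ j≤m) ⟩
    g j * (+ 4 * M⁻ m j)                  ≡⟨ lemma₃ (M⁻ m j) (g j) ⟩
    + 4 * (M⁻ m j * g j)                  ∎

reflection-bound′ : ∀ {m h} (g : ℕ → ℤ) → Poly m h →
  (∀ j → j ℕ.≤ m → 0ℤ ≤ g j) → (∀ j → j ℕ.≤ m → - g j ≤ h (- (q ^ j))) → (∀ j → j ℕ.≤ m → h (- (q ^ j)) ≤ g j) →
  + 3 * positive-functional m (λ j → M⁻ m j * h (q ^ j)) ≤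
  + 4 * positive-functional m (λ j → M⁻ m j * g j)
reflection-bound′ {m} {h} g Ph 0≤g lower upper =
  subst (λ u → + 3 * u ≤ + 4 * positive-functional m (λ j → M⁻ m j * g j))
    (functional-cong weight m λ j _ → cong (λ u → M⁻ m j * h u) (neg-involutive (q ^ j)))
    (reflection-bound g (Poly-neg-arg Ph) 0≤g lower upper)

0≤⇒-≤ : ∀ {g h} → 0ℤ ≤ g → 0ℤ ≤ h → - g ≤ h
0≤⇒-≤ 0≤g 0≤h = ≤-trans (neg-mono-≤ 0≤g) 0≤h

no-bivariate-sign-representation : ∀ {m} (P : ℤ → ℤ → ℤ) →
  (∀ t → Poly m (λ s → P s t)) → (∀ s → Poly m (P s)) →
  (∀ i j → i ℕ.≤ m → j ℕ.≤ m → 0ℤ < P (q ^ i) (q ^ j)) →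
  (∀ i j → i ℕ.≤ m → j ℕ.≤ m → 0ℤ < P (q ^ i) (- (q ^ j))) →
  (∀ i j → i ℕ.≤ m → j ℕ.≤ m → 0ℤ < P (- (q ^ i)) (q ^ j)) →
  (∀ i j → i ℕ.≤ m → j ℕ.≤ m → P (- (q ^ i)) (- (q ^ j)) < 0ℤ) → ⊥
no-bivariate-sign-representation {m} P Ps Pt P++ P+- P-+ P-- =
  <-irrefl refl (<-≤-trans 0<T (*-cancelˡ-≤ {+ 11} 0<+[ 10 ] 11T≤0))
  where
  Ψ = positive-functional m
  n₁ n₂ h : ℤ → ℤ
  n₁ s = Ψ (λ j → M⁻ m j * P s (q ^ j))
  n₂ s = Ψ (λ j → M⁻ m j * P s (- (q ^ j)))
  -- The factor 3 gives |h| ≤ n₁ at the negative nodes and h ≥ 3 n₁ at the positive ones.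
  h s = + 3 * (n₁ s + n₂ s)

  Poly-n₁ : Poly m n₁
  Poly-n₁ = Poly-functional weight m _ λ j → Poly-scale (M⁻ m j) (Ps (q ^ j))
  Poly-h : Poly m h
  Poly-h = Poly-scale (+ 3) (Poly-+ Poly-n₁
    (Poly-functional weight m _ λ j → Poly-scale (M⁻ m j) (Ps (- (q ^ j)))))

  Ψ-pos : ∀ {f : ℕ → ℤ} → (∀ j → j ℕ.≤ m → 0ℤ < f j) → 0ℤ < Ψ (λ j → M⁻ m j * f j)
  Ψ-pos 0<f = functional-positive weight m 0≤weight λ j j≤m → 0<* (0<M⁻ {m} {j} j≤m) (0<f j j≤m)

  0<n₁ : ∀ {i} → i ℕ.≤ m → 0ℤ < n₁ (q ^ i)
  0<n₁ {i} i≤m = Ψ-pos λ j j≤m → P++ i j i≤m j≤m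
  0<n₂ : ∀ {i} → i ℕ.≤ m → 0ℤ < n₂ (q ^ i)
  0<n₂ {i} i≤m = Ψ-pos λ j j≤m → P+- i j i≤m j≤m
  0<n₁⁻ : ∀ {i} → i ℕ.≤ m → 0ℤ < n₁ (- (q ^ i))
  0<n₁⁻ {i} i≤m = Ψ-pos λ j j≤m → P-+ i j i≤m j≤m

  Ψ-neg : ∀ (f : ℕ → ℤ) → Ψ (λ j → M⁻ m j * (-1ℤ * f j)) ≡ - Ψ (λ j → M⁻ m j * f j)
  Ψ-neg f = trans (functional-cong weight m λ j _ → lemma (M⁻ m j) (f j))
           (trans (functional-* weight m -1ℤ _) (-1*i≡-i _))
    where
    lemma : ∀ a b → a * (-1ℤ * b) ≡ -1ℤ * (a * b)
    lemma = solve-∀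

  -- At a negative node s the sign of P(s, t) is that of t, so the absolute values on either side
  -- can serve as the majorant `g` for a bound on the other side; this and the next inequality are
  -- the two directions.
  3n₁≤-4n₂ : ∀ {i} → i ℕ.≤ m → + 3 * n₁ (- (q ^ i)) ≤ + 4 * (- n₂ (- (q ^ i)))
  3n₁≤-4n₂ {i} i≤m =
    subst (λ u → + 3 * n₁ (- (q ^ i)) ≤ + 4 * u) (Ψ-neg (λ j → P (- (q ^ i)) (- (q ^ j))))
      (reflection-bound′ (λ j → -1ℤ * P (- (q ^ i)) (- (q ^ j))) (Pt (- (q ^ i)))
        0≤g
        (λ j j≤m → ≤-reflexive (trans (cong -_ (-1*i≡-i _)) (neg-involutive _)))
        (λ j j≤m → ≤-trans (<⇒≤ (P-- i j i≤m j≤m)) (0≤g j j≤m)))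
    where
    0≤g : ∀ j → j ℕ.≤ m → 0ℤ ≤ -1ℤ * P (- (q ^ i)) (- (q ^ j))
    0≤g j j≤m = subst (0ℤ ≤_) (sym (-1*i≡-i _)) (neg-mono-≤ (<⇒≤ (P-- i j i≤m j≤m)))

  -3n₂≤4n₁ : ∀ {i} → i ℕ.≤ m → + 3 * (- n₂ (- (q ^ i))) ≤ + 4 * n₁ (- (q ^ i))
  -3n₂≤4n₁ {i} i≤m =
    subst (λ u → + 3 * u ≤ + 4 * n₁ (- (q ^ i))) (Ψ-neg (λ j → P (- (q ^ i)) (- (q ^ j))))
      (reflection-bound (λ j → P (- (q ^ i)) (q ^ j)) (Poly-scale -1ℤ (Pt (- (q ^ i))))
        (λ j j≤m → <⇒≤ (P-+ i j i≤m j≤m))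
        (λ j j≤m → ≤-reflexive (sym (-1*i≡-i _)))
        (λ j j≤m → subst (_≤ P (- (q ^ i)) (q ^ j)) (sym (-1*i≡-i _))
                      (0≤⇒-≤ (<⇒≤ (P-+ i j i≤m j≤m)) (<⇒≤ (P-+ i j i≤m j≤m)))))

  h-upper : ∀ i → i ℕ.≤ m → h (- (q ^ i)) ≤ n₁ (- (q ^ i))
  h-upper i i≤m = *-cancelˡ-≤ {+ 4} 0<+[ 3 ]
    (≤-from-difference _ (lemma (n₁ (- (q ^ i))) (n₂ (- (q ^ i))))
      (0≤+ (0≤* {+ 3} (+≤+ ℕ.z≤n) (0≤difference (3n₁≤-4n₂ i≤m))) (<⇒≤ (0<n₁⁻ i≤m))))
    where
    lemma : ∀ a b → + 4 * a ≡ + 4 * (+ 3 * (a + b)) + (+ 3 * (+ 4 * (- b) - + 3 * a) + a)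
    lemma = solve-∀

  h-lower : ∀ i → i ℕ.≤ m → - n₁ (- (q ^ i)) ≤ h (- (q ^ i))
  h-lower i i≤m =
    ≤-from-difference _ (lemma (n₁ (- (q ^ i))) (n₂ (- (q ^ i)))) (0≤difference (-3n₂≤4n₁ i≤m))
    where
    lemma : ∀ a b → + 3 * (a + b) ≡ - a + (+ 4 * a - + 3 * (- b))
    lemma = solve-∀

  T U V : ℤ
  T = Ψ (λ i → M⁻ m i * n₁ (q ^ i))
  U = Ψ (λ i → M⁻ m i * n₁ (- (q ^ i)))
  V = Ψ (λ i → M⁻ m i * h (q ^ i))

  0<T : 0ℤ < T
  0<T = Ψ-pos λ i i≤m → 0<n₁ i≤m

  3V≤4U : + 3 * V ≤ + 4 * U
  3V≤4U = reflection-bound′ (λ i → n₁ (- (q ^ i))) Poly-h (λ i i≤m → <⇒≤ (0<n₁⁻ i≤m)) h-lower h-upper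

  3U≤4T : + 3 * U ≤ + 4 * T
  3U≤4T = reflection-bound (λ i → n₁ (q ^ i)) Poly-n₁ (λ i i≤m → <⇒≤ (0<n₁ i≤m))
    (λ i i≤m → 0≤⇒-≤ (<⇒≤ (0<n₁ i≤m)) (<⇒≤ (0<n₁ i≤m))) (λ i i≤m → ≤-refl)

  3T≤V : + 3 * T ≤ V
  3T≤V = subst (_≤ V) (functional-* weight m (+ 3) _) (functional-mono weight m 0≤weight λ i i≤m →
    ≤-from-difference _ (lemma (M⁻ m i) (n₁ (q ^ i)) (n₂ (q ^ i)))
      (0≤* {+ 3} (+≤+ ℕ.z≤n) (0≤* (<⇒≤ (0<M⁻ {m} {i} i≤m)) (<⇒≤ (0<n₂ i≤m)))))
    where
    lemma : ∀ c a b → c * (+ 3 * (a + b)) ≡ + 3 * (c * a) + + 3 * (c * b)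
    lemma = solve-∀

  -- Chaining the three bounds: 27 T ≤ 9 V ≤ 12 U ≤ 16 T.
  11T≤0 : + 11 * T ≤ + 11 * 0ℤ
  11T≤0 = ≤-from-difference _ (lemma T U V)
    (0≤+ (0≤+ (0≤* {+ 9} (+≤+ ℕ.z≤n) (0≤difference 3T≤V)) (0≤* {+ 3} (+≤+ ℕ.z≤n) (0≤difference 3V≤4U)))
         (0≤* {+ 4} (+≤+ ℕ.z≤n) (0≤difference 3U≤4T)))
    where
    lemma : ∀ T U V → + 11 * 0ℤ ≡
      + 11 * T + (+ 9 * (V - + 3 * T) + + 3 * (+ 4 * U - + 3 * V) + + 4 * (+ 4 * T - + 3 * U))
    lemma = solve-∀

-- Finitely supported signed measures

-- Zero and negative coefficients must be allowed: `side` is defined for every integer `l`, and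
-- outside the range 0 ≤ l ≤ L it can be a signed measure.
Measure : Set → Set
Measure X = List (ℤ × X)

∫ : ∀ {X} → Measure X → (X → ℤ) → ℤ
∫ List.[]              F = 0ℤ
∫ ((c , x) List.∷ μ) F = c * F x + ∫ μ F

scale : ∀ {X} → ℤ → Measure X → Measure X
scale c = List.map λ (d , x) → c * d , x

_⊗_ : ∀ {a b} → Measure (Vec Sign a) → Measure (Vec Sign b) → Measure (Vec Sign (a ℕ.+ b))
List.[]            ⊗ ν = List.[]
((c , x) List.∷ μ) ⊗ ν = List.map (λ (d , y) → c * d , x ++ y) ν List.++ (μ ⊗ ν)

∫-cong : ∀ {X} (μ : Measure X) {F G} → (∀ x → F x ≡ G x) → ∫ μ F ≡ ∫ μ G
∫-cong List.[]            F≗G = refl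
∫-cong ((c , x) List.∷ μ) F≗G = cong₂ (λ u v → c * u + v) (F≗G x) (∫-cong μ F≗G)

∫-+ : ∀ {X} (μ : Measure X) F G → ∫ μ (λ x → F x + G x) ≡ ∫ μ F + ∫ μ G
∫-+ List.[]            F G = refl
∫-+ ((c , x) List.∷ μ) F G =
  trans (cong₂ _+_ {x = c * (F x + G x)} refl (∫-+ μ F G)) (lemma c (F x) (G x) (∫ μ F) (∫ μ G))
  where
  lemma : ∀ c f g a b → c * (f + g) + (a + b) ≡ c * f + a + (c * g + b)
  lemma = solve-∀

∫-* : ∀ {X} (μ : Measure X) a F → ∫ μ (λ x → a * F x) ≡ a * ∫ μ F
∫-* List.[]            a F = sym (*-zeroʳ a)
∫-* ((c , x) List.∷ μ) a F = trans (cong₂ _+_ {x = c * (a * F x)} refl (∫-* μ a F)) (lemma c a (F x) (∫ μ F))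
  where
  lemma : ∀ c a f b → c * (a * f) + a * b ≡ a * (c * f + b)
  lemma = solve-∀

∫-sumℤ : ∀ {X} (μ : Measure X) k (F : Fin k → X → ℤ) →
         ∫ μ (λ x → sumℤ k (λ i → F i x)) ≡ sumℤ k (λ i → ∫ μ (F i))
∫-sumℤ μ zero    F = trans (∫-* μ 0ℤ (λ _ → 0ℤ)) refl
∫-sumℤ μ (suc k) F = trans (∫-+ μ _ _) (cong₂ _+_ {x = ∫ μ (F zero)} refl (∫-sumℤ μ k (F ∘ suc)))

∫-++ : ∀ {X} (μ ν : Measure X) F → ∫ (μ List.++ ν) F ≡ ∫ μ F + ∫ ν F
∫-++ List.[]            ν F = sym (+-identityˡ _)
∫-++ ((c , x) List.∷ μ) ν F =
  trans (cong₂ _+_ {x = c * F x} refl (∫-++ μ ν F)) (sym (+-assoc (c * F x) (∫ μ F) (∫ ν F)))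

∫-scale : ∀ {X} a (μ : Measure X) F → ∫ (scale a μ) F ≡ a * ∫ μ F
∫-scale a List.[]            F = sym (*-zeroʳ a)
∫-scale a ((c , x) List.∷ μ) F = trans (cong₂ _+_ {x = a * c * F x} refl (∫-scale a μ F)) (lemma a c (F x) (∫ μ F))
  where
  lemma : ∀ a c f b → a * c * f + a * b ≡ a * (c * f + b)
  lemma = solve-∀

∫-⊗ : ∀ {a b} (μ : Measure (Vec Sign a)) (ν : Measure (Vec Sign b)) F →
      ∫ (μ ⊗ ν) F ≡ ∫ μ (λ x → ∫ ν (λ y → F (x ++ y)))
∫-⊗ List.[]            ν F = refl
∫-⊗ ((c , x) List.∷ μ) ν F = trans (∫-++ (List.map _ ν) (μ ⊗ ν) F) (cong₂ _+_ (∫-map ν) (∫-⊗ μ ν F))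
  where
  lemma : ∀ c d f b → c * d * f + c * b ≡ c * (d * f + b)
  lemma = solve-∀
  ∫-map : ∀ ν → ∫ (List.map (λ (d , y) → c * d , x ++ y) ν) F ≡ c * ∫ ν (λ y → F (x ++ y))
  ∫-map List.[]            = sym (*-zeroʳ c)
  ∫-map ((d , y) List.∷ ν) =
    trans (cong₂ _+_ {x = c * d * F (x ++ y)} refl (∫-map ν)) (lemma c d (F (x ++ y)) (∫ ν (λ y → F (x ++ y))))

-- Characters

factor : Bool → Sign → ℤ
factor b s = if b then signℤ s else 1ℤ

character : ∀ {N} → Vec Bool N → Vec Sign N → ℤ
character []      []      = 1ℤ
character (b ∷ S) (s ∷ x) = factor b s * character S x

character-++ : ∀ {a b} (S : Vec Bool a) (T : Vec Bool b) x y →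
               character (S ++ T) (x ++ y) ≡ character S x * character T y
character-++ []      T []      y = sym (*-identityˡ _)
character-++ (b ∷ S) T (s ∷ x) y =
  trans (cong (factor b s *_) (character-++ S T x y)) (sym (*-assoc (factor b s) (character S x) (character T y)))

∫-⊗-character : ∀ {a b} (μ : Measure (Vec Sign a)) (ν : Measure (Vec Sign b)) S T →
  ∫ (μ ⊗ ν) (character (S ++ T)) ≡ ∫ μ (character S) * ∫ ν (character T)
∫-⊗-character μ ν S T = begin
  ∫ (μ ⊗ ν) (character (S ++ T))
    ≡⟨ ∫-⊗ μ ν _ ⟩
  ∫ μ (λ x → ∫ ν (λ y → character (S ++ T) (x ++ y)))
    ≡⟨ ∫-cong μ (λ x → trans (∫-cong ν (character-++ S T x))
         (trans (∫-* ν (character S x) (character T)) (*-comm (character S x) _))) ⟩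
  ∫ μ (λ x → ∫ ν (character T) * character S x)
    ≡⟨ ∫-* μ (∫ ν (character T)) (character S) ⟩
  ∫ ν (character T) * ∫ μ (character S)
    ≡⟨ *-comm (∫ ν (character T)) _ ⟩
  ∫ μ (character S) * ∫ ν (character T) ∎
  where open ≡-Reasoning

-- Sums of coordinates

total : ∀ {N} → Vec Sign N → ℤ
total []      = 0ℤ
total (s ∷ x) = signℤ s + total x

total-++ : ∀ {a b} (x : Vec Sign a) (y : Vec Sign b) → total (x ++ y) ≡ total x + total y
total-++ []      y = sym (+-identityˡ _)
total-++ (s ∷ x) y =
  trans (cong₂ _+_ {x = signℤ s} refl (total-++ x y)) (sym (+-assoc (signℤ s) (total x) (total y)))

-- States through test functions that `μ` acts as a nonzero nonnegative measure on the points of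
-- total `v`. Supports are never mentioned, so terms of coefficient zero may sit at arbitrary
-- points.
PositiveOn : ∀ {N} → Measure (Vec Sign N) → ℤ → Set
PositiveOn {N} μ v = ∀ (F : Vec Sign N → ℤ) → (∀ x → total x ≡ v → 0ℤ < F x) → 0ℤ < ∫ μ F

PositiveOn-⊗ : ∀ {a b u v} (μ : Measure (Vec Sign a)) (ν : Measure (Vec Sign b)) →
               PositiveOn μ u → PositiveOn ν v → PositiveOn (μ ⊗ ν) (u + v)
PositiveOn-⊗ μ ν μ-pos ν-pos F 0<F = subst (0ℤ <_) (sym (∫-⊗ μ ν F))
  (μ-pos _ λ x tx → ν-pos _ λ y ty → 0<F (x ++ y) (trans (total-++ x y) (cong₂ _+_ tx ty)))

PositiveOn-scale : ∀ {a u} c (μ : Measure (Vec Sign a)) → 0ℤ < c → PositiveOn μ u → PositiveOn (scale c μ) u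
PositiveOn-scale c μ 0<c μ-pos F 0<F = subst (0ℤ <_) (sym (∫-scale c μ F)) (0<* 0<c (μ-pos F 0<F))

PositiveOn-++ : ∀ {a u} (μ ν : Measure (Vec Sign a)) →
                PositiveOn μ u → PositiveOn ν u → PositiveOn (μ List.++ ν) u
PositiveOn-++ μ ν μ-pos ν-pos F 0<F = subst (0ℤ <_) (sym (∫-++ μ ν F)) (+-mono-< (μ-pos F 0<F) (ν-pos F 0<F))

-- At an endpoint of the range of `l` one half of `side` has coefficient zero, while the parameter
-- of that half has left the range; its positivity cannot be asked for.
PositiveOn-++-scale0 : ∀ {a u} (μ ν : Measure (Vec Sign a)) →
                       PositiveOn μ u → PositiveOn (μ List.++ scale 0ℤ ν) u
PositiveOn-++-scale0 μ ν μ-pos F 0<F =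
  subst (0ℤ <_)
    (sym (trans (∫-++ μ (scale 0ℤ ν) F)
                (trans (cong₂ _+_ {x = ∫ μ F} refl (∫-scale 0ℤ ν F)) (+-identityʳ _))))
    (μ-pos F 0<F)

PositiveOn-scale0-++ : ∀ {a u} (μ ν : Measure (Vec Sign a)) →
                       PositiveOn ν u → PositiveOn (scale 0ℤ μ List.++ ν) u
PositiveOn-scale0-++ μ ν ν-pos F 0<F =
  subst (0ℤ <_)
    (sym (trans (∫-++ (scale 0ℤ μ) ν F) (trans (cong (_+ ∫ ν F) (∫-scale 0ℤ μ F)) (+-identityˡ _))))
    (ν-pos F 0<F)

-- Random substitutions

δ : ∀ {X : Set} → X → Measure X
δ x = (1ℤ , x) List.∷ List.[]

PositiveOn-δ : ∀ {a} (x : Vec Sign a) → PositiveOn (δ x) (total x)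
PositiveOn-δ x F 0<F = subst (0ℤ <_) (lemma (F x)) (0<F x refl)
  where
  lemma : ∀ a → a ≡ 1ℤ * a + 0ℤ
  lemma = solve-∀

live-pair : Sign → Measure (Vec Sign 2)
live-pair s = δ (s ∷ s ∷ [])

dead-pair : Measure (Vec Sign 2)
dead-pair = δ (Sign.+ ∷ Sign.- ∷ []) List.++ δ (Sign.- ∷ Sign.+ ∷ [])

dead : ∀ r → Measure (Vec Sign (r ℕ.* 2))
dead zero    = δ []
dead (suc r) = dead-pair ⊗ dead r

block : ∀ {r} → Fin r → Sign → Measure (Vec Sign (r ℕ.* 2))
block {suc r} zero    s = live-pair s ⊗ dead r
block {suc r} (suc i) s = dead-pair ⊗ block i s

-- For 0 ≤ l ≤ L this is a positive multiple of the uniform distribution on the settings of the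
-- L logical variables with exactly l minus signs, pushed through the blocks.
side : ∀ {r L} → Vec (Fin r) L → ℤ → Measure (Vec Sign (L ℕ.* (r ℕ.* 2)))
side []                  l = δ []
side {L = suc L} (i ∷ z) l =
  scale (+ suc L - l) (block i Sign.+ ⊗ side z l) List.++ scale l (block i Sign.- ⊗ side z (l - 1ℤ))

PositiveOn-dead-pair : PositiveOn dead-pair 0ℤ
PositiveOn-dead-pair =
  PositiveOn-++ (δ (Sign.+ ∷ Sign.- ∷ [])) (δ (Sign.- ∷ Sign.+ ∷ [])) (PositiveOn-δ _) (PositiveOn-δ _)

PositiveOn-dead : ∀ r → PositiveOn (dead r) 0ℤ
PositiveOn-dead zero    = PositiveOn-δ []
PositiveOn-dead (suc r) = PositiveOn-⊗ dead-pair (dead r) PositiveOn-dead-pair (PositiveOn-dead r)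

PositiveOn-block : ∀ {r} (i : Fin r) s → PositiveOn (block i s) (signℤ s + signℤ s)
PositiveOn-block {suc r} zero s =
  subst (PositiveOn (block {suc r} zero s)) (lemma (signℤ s))
    (PositiveOn-⊗ (live-pair s) (dead r) (PositiveOn-δ (s ∷ s ∷ [])) (PositiveOn-dead r))
  where
  lemma : ∀ a → (a + (a + 0ℤ)) + 0ℤ ≡ a + a
  lemma = solve-∀
PositiveOn-block {suc r} (suc i) s =
  subst (PositiveOn (block (suc i) s)) (+-identityˡ (signℤ s + signℤ s))
    (PositiveOn-⊗ dead-pair (block i s) PositiveOn-dead-pair (PositiveOn-block i s))

-- A logical variable contributes twice its sign, and l of the L variables are minus: 2(L - l) - 2l.
PositiveOn-side : ∀ {r L} (z : Vec (Fin r) L) l → l ℕ.≤ L → PositiveOn (side z (+ l)) (+ 2 * + L - + 4 * + l)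
PositiveOn-side []      .0 ℕ.z≤n = PositiveOn-δ []
PositiveOn-side {L = suc L} (i ∷ z) zero _ =
  PositiveOn-++-scale0 (scale (+ suc L - 0ℤ) μ⁺) (block i Sign.- ⊗ side z (0ℤ - 1ℤ))
    (PositiveOn-scale (+ suc L - 0ℤ) μ⁺ 0<+[ L ℕ.+ 0 ]
      (subst (PositiveOn μ⁺) (lemma (+ L))
        (PositiveOn-⊗ (block i Sign.+) (side z 0ℤ) (PositiveOn-block i Sign.+) (PositiveOn-side z 0 ℕ.z≤n))))
  where
  μ⁺ = block i Sign.+ ⊗ side z 0ℤ
  lemma : ∀ L → + 2 + (+ 2 * L - + 4 * 0ℤ) ≡ + 2 * (1ℤ + L) - + 4 * 0ℤ
  lemma = solve-∀
PositiveOn-side {L = suc L} (i ∷ z) (suc l) (ℕ.s≤s l≤L) = case (ℕ.m≤n⇒m<n∨m≡n l≤L)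
  where
  μ⁺ = block i Sign.+ ⊗ side z (+ suc l)
  μ⁻ = block i Sign.- ⊗ side z (+ l)
  lemma⁺ : ∀ L l → + 2 + (+ 2 * L - + 4 * l) ≡ + 2 * (1ℤ + L) - + 4 * l
  lemma⁺ = solve-∀
  lemma⁻ : ∀ L l → - + 2 + (+ 2 * L - + 4 * l) ≡ + 2 * (1ℤ + L) - + 4 * (1ℤ + l)
  lemma⁻ = solve-∀
  pos⁻ : PositiveOn (scale (+ suc l) μ⁻) (+ 2 * + suc L - + 4 * + suc l)
  pos⁻ = PositiveOn-scale (+ suc l) μ⁻ 0<+[ l ]
    (subst (PositiveOn μ⁻) (lemma⁻ (+ L) (+ l))
      (PositiveOn-⊗ (block i Sign.-) (side z (+ l)) (PositiveOn-block i Sign.-) (PositiveOn-side z l l≤L)))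
  case : l ℕ.< L ⊎ l ≡ L → PositiveOn (side (i ∷ z) (+ suc l)) (+ 2 * + suc L - + 4 * + suc l)
  case (inj₁ l<L) = PositiveOn-++ (scale (+ suc L - + suc l) μ⁺) (scale (+ suc l) μ⁻)
    (PositiveOn-scale (+ suc L - + suc l) μ⁺ (0<difference (+<+ (ℕ.s≤s l<L)))
      (subst (PositiveOn μ⁺) (lemma⁺ (+ L) (+ suc l))
        (PositiveOn-⊗ (block i Sign.+) (side z (+ suc l)) (PositiveOn-block i Sign.+) (PositiveOn-side z (suc l) l<L))))
    pos⁻
  case (inj₂ refl) =
    subst (λ c → PositiveOn (scale c μ⁺ List.++ scale (+ suc l) μ⁻) (+ 2 * + suc L - + 4 * + suc l))
      (sym (+-inverseʳ (+ suc l)))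
      (PositiveOn-scale0-++ μ⁺ (scale (+ suc l) μ⁻) pos⁻)

-- Averages of characters

splits : ∀ r → Vec Bool (r ℕ.* 2) → Bool
splits zero    []          = false
splits (suc r) (a ∷ b ∷ T) = (a xor b) ∨ splits r T

∫-dead-pair : ∀ a b → (a xor b) ≡ true → ∫ dead-pair (character (a ∷ b ∷ [])) ≡ 0ℤ
∫-dead-pair true  false _ = refl
∫-dead-pair false true  _ = refl

-- When a set contains exactly one member of a pair, the points (+,-) and (-,+) contribute opposite
-- values, and that factor of the product measure vanishes.
∫-dead : ∀ r T → splits r T ≡ true → ∫ (dead r) (character T) ≡ 0ℤ
∫-dead zero    []          ()
∫-dead (suc r) (a ∷ b ∷ T) split =
  trans (∫-⊗-character dead-pair (dead r) (a ∷ b ∷ []) T) (case (a xor b) refl split)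
  where
  I = ∫ dead-pair (character (a ∷ b ∷ []))
  case : ∀ c → (a xor b) ≡ c → c ∨ splits r T ≡ true → I * ∫ (dead r) (character T) ≡ 0ℤ
  case true  eq _     = cong (_* ∫ (dead r) (character T)) (∫-dead-pair a b eq)
  case false eq split = trans (cong (I *_) (∫-dead r T split)) (*-zeroʳ I)

data Kind : Set where
  killed even odd : Kind

-- A split dead pair averages to zero. On the live pair (w, w) a character equals w if it splits the
-- pair, and 1 or w² = 1 otherwise.
kind : ∀ {r} → Fin r → Vec Bool (r ℕ.* 2) → Kind
kind {suc r} zero    (a ∷ b ∷ T) = if splits r T then killed else if a xor b then odd else even
kind {suc r} (suc i) (a ∷ b ∷ T) = if a xor b then killed else kind i T

HasKind : Kind → (Sign → ℤ) → Set
HasKind killed f = ∀ s → f s ≡ 0ℤ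
HasKind even   f = f Sign.- ≡ f Sign.+
HasKind odd    f = f Sign.- ≡ - f Sign.+

HasKind-ext : ∀ k {f g} → (∀ s → g s ≡ f s) → HasKind k f → HasKind k g
HasKind-ext killed g≗f hyp s = trans (g≗f s) (hyp s)
HasKind-ext even   g≗f hyp   = trans (g≗f _) (trans hyp (sym (g≗f _)))
HasKind-ext odd    g≗f hyp   = trans (g≗f _) (trans hyp (cong -_ (sym (g≗f _))))

HasKind-*ˡ : ∀ k c {f} → HasKind k f → HasKind k (λ s → c * f s)
HasKind-*ˡ killed c hyp s = trans (cong (c *_) (hyp s)) (*-zeroʳ c)
HasKind-*ˡ even   c hyp   = cong (c *_) hyp
HasKind-*ˡ odd    c hyp   = trans (cong (c *_) hyp) (sym (neg-distribʳ-* c _))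

HasKind-live-pair : ∀ a b →
  HasKind (if a xor b then odd else even) (λ s → ∫ (live-pair s) (character (a ∷ b ∷ [])))
HasKind-live-pair true  true  = refl
HasKind-live-pair true  false = refl
HasKind-live-pair false true  = refl
HasKind-live-pair false false = refl

kind-correct : ∀ {r} (i : Fin r) T → HasKind (kind i T) (λ s → ∫ (block i s) (character T))
kind-correct {suc r} zero (a ∷ b ∷ T) =
  HasKind-ext (kind {suc r} zero (a ∷ b ∷ T))
    (λ s → trans (∫-⊗-character (live-pair s) (dead r) (a ∷ b ∷ []) T)
                 (*-comm (∫ (live-pair s) (character (a ∷ b ∷ []))) D))
    (case (splits r T) refl)
  where
  D = ∫ (dead r) (character T)
  case : ∀ c → splits r T ≡ c →
    HasKind (if c then killed else if a xor b then odd else even)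
            (λ s → D * ∫ (live-pair s) (character (a ∷ b ∷ [])))
  case true  eq s = cong (_* ∫ (live-pair s) (character (a ∷ b ∷ []))) (∫-dead r T eq)
  case false eq   = HasKind-*ˡ (if a xor b then odd else even) D (HasKind-live-pair a b)
kind-correct {suc r} (suc i) (a ∷ b ∷ T) =
  HasKind-ext (kind (suc i) (a ∷ b ∷ T))
    (λ s → ∫-⊗-character dead-pair (block i s) (a ∷ b ∷ []) T)
    (case (a xor b) refl)
  where
  I = ∫ dead-pair (character (a ∷ b ∷ []))
  case : ∀ c → (a xor b) ≡ c →
    HasKind (if c then killed else kind i T) (λ s → I * ∫ (block i s) (character T))
  case true  eq s = cong (_* ∫ (block i s) (character T)) (∫-dead-pair a b eq)
  case false eq   = HasKind-*ˡ (kind i T) I (kind-correct i T)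

-- nothing stands for the zero polynomial, i.e. a monomial that is averaged out.
Degree : Set
Degree = Maybe ℕ

PolyOf : Degree → (ℤ → ℤ) → Set
PolyOf nothing  f = ∀ x → f x ≡ 0ℤ
PolyOf (just d) f = Poly d f

_⊞_ : Kind → Degree → Degree
killed ⊞ d = nothing
even   ⊞ d = d
odd    ⊞ d = Maybe.map suc d

degree : ∀ {r L} → Vec (Fin r) L → Vec Bool (L ℕ.* (r ℕ.* 2)) → Degree
degree             []      S = just 0
degree {r} (i ∷ z) S = kind i (take (r ℕ.* 2) S) ⊞ degree z (drop (r ℕ.* 2) S)

-- An even block yields a multiple of (a - l) g(l) + l g(l - 1), whose degree `Poly-average`
-- controls. An odd block turns the plus into a minus, the leading terms no longer cancel, and the
-- degree bound grows by one.
PolyOf-step : ∀ k d {β : Sign → ℤ} {g : ℤ → ℤ} a → HasKind k β → PolyOf d g →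
  PolyOf (k ⊞ d) (λ l → (a - l) * (β Sign.+ * g l) + l * (β Sign.- * g (l - 1ℤ)))
PolyOf-step killed d {β} {g} a hβ Pg l rewrite hβ Sign.+ | hβ Sign.- = cong₂ _+_ (*-zeroʳ (a - l)) (*-zeroʳ l)
PolyOf-step even nothing {β} {g} a hβ Pg l rewrite Pg l | Pg (l - 1ℤ) | *-zeroʳ (β Sign.+) | *-zeroʳ (β Sign.-) =
  cong₂ _+_ (*-zeroʳ (a - l)) (*-zeroʳ l)
PolyOf-step odd nothing {β} {g} a hβ Pg l rewrite Pg l | Pg (l - 1ℤ) | *-zeroʳ (β Sign.+) | *-zeroʳ (β Sign.-) =
  cong₂ _+_ (*-zeroʳ (a - l)) (*-zeroʳ l)
PolyOf-step even (just d) {β} {g} a hβ Pg rewrite hβ =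
  Poly-ext (λ l → lemma a (β Sign.+) l (g l) (g (l - 1ℤ))) (Poly-scale (β Sign.+) (Poly-average a Pg))
  where
  lemma : ∀ a b l u v → (a - l) * (b * u) + l * (b * v) ≡ b * ((a - l) * u + l * v)
  lemma = solve-∀
PolyOf-step odd (just d) {β} {g} a hβ Pg rewrite hβ =
  Poly-ext (λ l → lemma a (β Sign.+) l (g l) (g (l - 1ℤ)))
    (Poly-scale (β Sign.+) (Poly-+ (Poly-affine a -1ℤ Pg) (Poly-affine 0ℤ -1ℤ (Poly-pred Pg))))
  where
  lemma : ∀ a b l u v → (a - l) * (b * u) + l * ((- b) * v) ≡ b * ((a + -1ℤ * l) * u + (0ℤ + -1ℤ * l) * v)
  lemma = solve-∀

PolyOf-ext : ∀ d {f g} → (∀ x → g x ≡ f x) → PolyOf d f → PolyOf d g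
PolyOf-ext nothing  g≗f f≗0 x = trans (g≗f x) (f≗0 x)
PolyOf-ext (just d) g≗f Pf    = Poly-ext g≗f Pf

degree-correct : ∀ {r L} (z : Vec (Fin r) L) S → PolyOf (degree z S) (λ l → ∫ (side z l) (character S))
degree-correct [] [] = constant 1ℤ λ _ → refl
degree-correct {r} {suc L} (i ∷ z) S =
  PolyOf-ext (degree (i ∷ z) S) expand
    (PolyOf-step (kind i T) (degree z S') {λ s → ∫ (block i s) (character T)} {λ l → ∫ (side z l) (character S')}
      (+ suc L) (kind-correct i T) (degree-correct z S'))
  where
  T = take (r ℕ.* 2) S
  S' = drop (r ℕ.* 2) S
  part : ∀ c s l → ∫ (scale c (block i s ⊗ side z l)) (character S) ≡
                   c * (∫ (block i s) (character T) * ∫ (side z l) (character S'))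
  part c s l = trans (∫-scale c (block i s ⊗ side z l) (character S))
    (cong (c *_) (trans (cong (λ S → ∫ (block i s ⊗ side z l) (character S)) (sym (take++drop≡id (r ℕ.* 2) S)))
                        (∫-⊗-character (block i s) (side z l) T S')))
  expand : ∀ l → ∫ (side (i ∷ z) l) (character S) ≡
    (+ suc L - l) * (∫ (block i Sign.+) (character T) * ∫ (side z l) (character S')) +
    l * (∫ (block i Sign.-) (character T) * ∫ (side z (l - 1ℤ)) (character S'))
  expand l = trans (∫-++ (scale (+ suc L - l) (block i Sign.+ ⊗ side z l)) _ (character S))
    (cong₂ _+_ (part (+ suc L - l) Sign.+ l) (part l Sign.- (l - 1ℤ)))

-- Choosing the live pairs

sum-mono : ∀ {k} {f g : Fin k → ℕ} → (∀ j → f j ℕ.≤ g j) → sum f ℕ.≤ sum g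
sum-mono {zero}  f≤g = ℕ.z≤n
sum-mono {suc k} f≤g = ℕ.+-mono-≤ (f≤g zero) (sum-mono (f≤g ∘ suc))

term≤sum : ∀ {k} (f : Fin k → ℕ) j → f j ℕ.≤ sum f
term≤sum f zero    = ℕ.m≤m+n (f zero) _
term≤sum f (suc j) = ℕ.≤-trans (term≤sum (f ∘ suc) j) (ℕ.m≤n+m _ (f zero))

below-average : ∀ {r} c (f : Fin (suc r) → ℕ) → sum f ℕ.≤ suc r ℕ.* c → ∃ λ i → f i ℕ.≤ c
below-average {r} c f Σf≤ with f zero ℕ.≤? c
... | yes f₀≤c = zero , f₀≤c
below-average {zero} c f Σf≤ | no f₀≰c = zero , ℕ.≤-trans (ℕ.m≤m+n _ _) (subst (sum f ℕ.≤_) (ℕ.+-identityʳ c) Σf≤)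
below-average {suc r} c f Σf≤ | no f₀≰c =
  let i , fi≤c = below-average c (f ∘ suc) (ℕ.+-cancelˡ-≤ c _ _ (ℕ.≤-trans (ℕ.+-monoˡ-≤ _ (ℕ.≰⇒≥ f₀≰c)) Σf≤))
  in suc i , fi≤c

kind-weight : ℕ → Kind → ℕ
kind-weight R killed = 0
kind-weight R even   = 1
kind-weight R odd    = R

degree-weight : ℕ → Degree → ℕ
degree-weight R nothing  = 0
degree-weight R (just d) = R ℕ.^ d

degree-weight-⊞ : ∀ R k d → degree-weight R (k ⊞ d) ≡ kind-weight R k ℕ.* degree-weight R d
degree-weight-⊞ R killed d        = refl
degree-weight-⊞ R even   d        = sym (ℕ.+-identityʳ _)
degree-weight-⊞ R odd    nothing  = sym (ℕ.*-zeroʳ R)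
degree-weight-⊞ R odd    (just d) = refl

-- If `T` splits no pair, each of the r choices is even. If it splits exactly one, only the choice
-- of that pair survives, with weight `R`; if it splits more, none does. `R` is kept apart from `r`
-- because the induction shrinks only `r`.
sum-kind-weight : ∀ R r T → sum (λ i → kind-weight R (kind {r} i T)) ℕ.≤ (if splits r T then R else r)
sum-kind-weight R zero    []          = ℕ.z≤n
sum-kind-weight R (suc r) (a ∷ b ∷ T) with a xor b | splits r T | sum-kind-weight R r T
... | true  | true  | _  = ℕ.≤-trans (ℕ.≤-reflexive (sum-replicate-zero r)) ℕ.z≤n
... | true  | false | _  = ℕ.≤-reflexive (trans (cong (R ℕ.+_) (sum-replicate-zero r)) (ℕ.+-identityʳ R))
... | false | true  | IH = IH
... | false | false | IH = ℕ.s≤s IH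

sum-kind-weight≤ : ∀ r T → sum (λ i → kind-weight r (kind {r} i T)) ℕ.≤ r
sum-kind-weight≤ r T with splits r T | sum-kind-weight r r T
... | true  | ≤r = ≤r
... | false | ≤r = ≤r

-- The method of conditional expectations: by `sum-kind-weight≤` a uniformly random live pair
-- multiplies each weight by at most 1 on average, so some choice does not raise the total. The
-- coefficients `c` carry the weights earned in the blocks already settled.
choose-live-pairs : ∀ r L {k} (S : Fin k → Vec Bool (L ℕ.* (suc r ℕ.* 2))) (c : Fin k → ℕ) →
  ∃ λ (z : Vec (Fin (suc r)) L) → sum (λ j → c j ℕ.* degree-weight (suc r) (degree z (S j))) ℕ.≤ sum c
choose-live-pairs r zero    S c = [] , ℕ.≤-reflexive (sum-cong-≗ λ j → ℕ.*-identityʳ (c j))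
choose-live-pairs r (suc L) S c = (i ∷ z) , (begin
  sum (λ j → c j ℕ.* degree-weight R (degree (i ∷ z) (S j)))
    ≡⟨ sum-cong-≗ (λ j → trans (cong (c j ℕ.*_) (degree-weight-⊞ R (kind i (head j)) (degree z (tail j))))
                               (sym (ℕ.*-assoc (c j) (w i j) (degree-weight R (degree z (tail j)))))) ⟩
  sum (λ j → c j ℕ.* w i j ℕ.* degree-weight R (degree z (tail j)))
    ≤⟨ proj₂ rest ⟩
  sum (λ j → c j ℕ.* w i j)
    ≤⟨ proj₂ first ⟩
  sum c ∎)
  where
  open ℕ.≤-Reasoning
  R = suc r
  head = λ j → take (R ℕ.* 2) (S j)
  tail = λ j → drop (R ℕ.* 2) (S j)
  w : Fin R → _ → ℕ
  w i j = kind-weight R (kind i (head j))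
  first : ∃ λ i → sum (λ j → c j ℕ.* w i j) ℕ.≤ sum c
  first = below-average (sum c) _ (begin
    sum (λ i → sum (λ j → c j ℕ.* w i j))  ≡⟨ ∑-comm (λ i j → c j ℕ.* w i j) ⟩
    sum (λ j → sum (λ i → c j ℕ.* w i j))  ≡⟨ sum-cong-≗ (λ j → *-distribˡ-sum (c j) (λ i → w i j)) ⟨
    sum (λ j → c j ℕ.* sum (λ i → w i j))  ≤⟨ sum-mono (λ j → ℕ.*-monoʳ-≤ (c j) (sum-kind-weight≤ R (head j))) ⟩
    sum (λ j → c j ℕ.* R)                  ≡⟨ sum-cong-≗ (λ j → ℕ.*-comm (c j) R) ⟩
    sum (λ j → R ℕ.* c j)                  ≡⟨ *-distribˡ-sum R c ⟨
    R ℕ.* sum c                            ∎)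
  i = proj₁ first
  rest = choose-live-pairs r L tail (λ j → c j ℕ.* w i j)
  z = proj₁ rest

-- Finite sums of integers

sumℤ-cong : ∀ k {f g : Fin k → ℤ} → (∀ i → f i ≡ g i) → sumℤ k f ≡ sumℤ k g
sumℤ-cong zero    f≗g = refl
sumℤ-cong (suc k) f≗g = cong₂ _+_ (f≗g zero) (sumℤ-cong k (f≗g ∘ suc))

sumℤ-* : ∀ k a (f : Fin k → ℤ) → sumℤ k (λ i → a * f i) ≡ a * sumℤ k f
sumℤ-* zero    a f = sym (*-zeroʳ a)
sumℤ-* (suc k) a f =
  trans (cong₂ _+_ {x = a * f zero} refl (sumℤ-* k a (f ∘ suc))) (sym (*-distribˡ-+ a (f zero) _))

-- Clearing denominators

toℚᵘ-signℚ : ∀ s → toℚᵘ (signℚ s) ≡ mkℚᵘ (signℤ s) 0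
toℚᵘ-signℚ Sign.+ = refl
toℚᵘ-signℚ Sign.- = refl

-- The products with 1 come from the denominator of `signℚ s`; they are kept so that the right side
-- has the shape to which unnormalised addition computes.
common-denominator : ∀ a s N d →
  toℚᵘ (a ℚ.* signℚ s) ℚᵘ.+ mkℚᵘ N d ≃
  mkℚᵘ (ℚ.numerator a * + suc d * signℤ s + + suc (ℚ.denominator-1 a ℕ.* 1) * N)
       (d ℕ.+ ℚ.denominator-1 a ℕ.* 1 ℕ.* suc d)
common-denominator a@(mkℚ n e _) s N d = begin
  toℚᵘ (a ℚ.* signℚ s) ℚᵘ.+ mkℚᵘ N d
    ≈⟨ ℚᵘ.+-congˡ (mkℚᵘ N d) (ℚ.toℚᵘ-homo-* a (signℚ s)) ⟩
  toℚᵘ a ℚᵘ.* toℚᵘ (signℚ s) ℚᵘ.+ mkℚᵘ N d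
    ≡⟨ cong (λ u → toℚᵘ a ℚᵘ.* u ℚᵘ.+ mkℚᵘ N d) (toℚᵘ-signℚ s) ⟩
  mkℚᵘ (n * signℤ s * + suc d + N * + suc (e ℕ.* 1)) (d ℕ.+ e ℕ.* 1 ℕ.* suc d)
    ≡⟨ cong (λ u → mkℚᵘ u (d ℕ.+ e ℕ.* 1 ℕ.* suc d)) (lemma n (+ suc d) (+ suc (e ℕ.* 1)) (signℤ s) N) ⟩
  mkℚᵘ (n * + suc d * signℤ s + + suc (e ℕ.* 1) * N) (d ℕ.+ e ℕ.* 1 ℕ.* suc d) ∎
  where
  open ℚᵘ.≃-Reasoning
  lemma : ∀ n D E s N → n * s * D + N * E ≡ n * D * s + E * N
  lemma = solve-∀

-- The coefficients and the denominator `suc d` are fixed before the signs `s`, so one integer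
-- polynomial has the right sign at all points.
clear-denominators : ∀ k (λs : Fin k → ℚ) → ∃ λ (c : Fin k → ℤ) → ∃ λ d → ∀ (s : Fin k → Sign) →
  toℚᵘ (sumℚ k (λ i → λs i ℚ.* signℚ (s i))) ≃ mkℚᵘ (sumℤ k (λ i → c i * signℤ (s i))) d
clear-denominators zero    λs = (λ ()) , 0 , λ _ → ℚᵘ.≃-refl
clear-denominators (suc k) λs with clear-denominators k (λs ∘ suc)
... | c , d , IH = c′ , d′ , rep
  where
  E = + suc (ℚ.denominator-1 (λs zero) ℕ.* 1)
  d′ = d ℕ.+ ℚ.denominator-1 (λs zero) ℕ.* 1 ℕ.* suc d
  c′ : Fin (suc k) → ℤ
  c′ zero    = ℚ.numerator (λs zero) * + suc d
  c′ (suc i) = E * c i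
  rep : ∀ (s : Fin (suc k) → Sign) → toℚᵘ (sumℚ (suc k) (λ i → λs i ℚ.* signℚ (s i))) ≃
                                     mkℚᵘ (sumℤ (suc k) (λ i → c′ i * signℤ (s i))) d′
  rep s = begin
    toℚᵘ (λs zero ℚ.* signℚ (s zero) ℚ.+ rest)
      ≈⟨ ℚ.toℚᵘ-homo-+ (λs zero ℚ.* signℚ (s zero)) rest ⟩
    toℚᵘ (λs zero ℚ.* signℚ (s zero)) ℚᵘ.+ toℚᵘ rest
      ≈⟨ ℚᵘ.+-congʳ (toℚᵘ (λs zero ℚ.* signℚ (s zero))) (IH (s ∘ suc)) ⟩
    toℚᵘ (λs zero ℚ.* signℚ (s zero)) ℚᵘ.+ mkℚᵘ N d
      ≈⟨ common-denominator (λs zero) (s zero) N d ⟩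
    mkℚᵘ (c′ zero * signℤ (s zero) + E * N) d′
      ≡⟨ cong (λ u → mkℚᵘ (c′ zero * signℤ (s zero) + u) d′)
           (trans (sym (sumℤ-* k E (λ i → c i * signℤ (s (suc i)))))
                  (sumℤ-cong k λ i → sym (*-assoc E (c i) (signℤ (s (suc i)))))) ⟩
    mkℚᵘ (sumℤ (suc k) (λ i → c′ i * signℤ (s i))) d′ ∎
    where
    open ℚᵘ.≃-Reasoning
    rest = sumℚ k (λ i → λs (suc i) ℚ.* signℚ (s (suc i)))
    N = sumℤ k (λ i → c i * signℤ (s (suc i)))

0<-numerator : ∀ {p N d} → toℚᵘ p ≃ mkℚᵘ N d → 0ℚ ℚ.< p → 0ℤ < N
0<-numerator {N = N} eq 0<p with ℚᵘ.<-respʳ-≃ eq (ℚ.toℚᵘ-mono-< 0<p)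
... | *<* 0<N = subst₂ _<_ refl (*-identityʳ N) 0<N

numerator-<0 : ∀ {p N d} → toℚᵘ p ≃ mkℚᵘ N d → p ℚ.< 0ℚ → N < 0ℤ
numerator-<0 {N = N} eq p<0 with ℚᵘ.<-respˡ-≃ eq (ℚ.toℚᵘ-mono-< p<0)
... | *<* N<0 = subst₂ _<_ (*-identityʳ N) refl N<0

-- Evaluation of majorities and monomials on concatenated vectors

signℤ-* : ∀ s t → signℤ (s Sign.* t) ≡ signℤ s * signℤ t
signℤ-* Sign.+ Sign.+ = refl
signℤ-* Sign.+ Sign.- = refl
signℤ-* Sign.- Sign.+ = refl
signℤ-* Sign.- Sign.- = refl

monomial-lookup : ∀ {N} (S : Vec Bool N) (x : Vec Sign N) → signℤ (monomial S (lookup x)) ≡ character S x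
monomial-lookup []          []      = refl
monomial-lookup (true  ∷ S) (s ∷ x) =
  trans (signℤ-* s (monomial S (lookup x))) (cong (signℤ s *_) (monomial-lookup S x))
monomial-lookup (false ∷ S) (s ∷ x) =
  trans (signℤ-* Sign.+ (monomial S (lookup x))) (cong (1ℤ *_) (monomial-lookup S x))

sumℤ-lookup : ∀ {N} (x : Vec Sign N) → sumℤ N (λ i → signℤ (lookup x i)) ≡ total x
sumℤ-lookup []      = refl
sumℤ-lookup (s ∷ x) = cong₂ _+_ {x = signℤ s} refl (sumℤ-lookup x)

MAJ-positive : ∀ n x → 0ℤ < sumℤ n (λ i → signℤ (x i)) → MAJ n x ≡ Sign.+
MAJ-positive n x 0<Σ with 0ℤ <? sumℤ n (λ i → signℤ (x i))
... | yes _   = refl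
... | no  0≮Σ = ⊥-elim (0≮Σ 0<Σ)

MAJ-negative : ∀ n x → sumℤ n (λ i → signℤ (x i)) < 0ℤ → MAJ n x ≡ Sign.-
MAJ-negative n x Σ<0 with 0ℤ <? sumℤ n (λ i → signℤ (x i))
... | yes 0<Σ = ⊥-elim (<-asym 0<Σ Σ<0)
... | no  _   = refl

module _ {n} (x y : Vec Sign n) where
  private
    left : sumℤ n (λ i → signℤ (lookup (x ++ y) (i ↑ˡ n))) ≡ total x
    left = trans (sumℤ-cong n λ i → cong signℤ (lookup-++ˡ x y i)) (sumℤ-lookup x)
    right : sumℤ n (λ i → signℤ (lookup (x ++ y) (n ↑ʳ i))) ≡ total y
    right = trans (sumℤ-cong n λ i → cong signℤ (lookup-++ʳ x y i)) (sumℤ-lookup y)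

  majAndMaj-positiveˡ : 0ℤ < total x → majAndMaj n (lookup (x ++ y)) ≡ Sign.+
  majAndMaj-positiveˡ 0<x
    rewrite MAJ-positive n (λ i → lookup (x ++ y) (i ↑ˡ n)) (subst (0ℤ <_) (sym left) 0<x) = refl

  majAndMaj-positiveʳ : 0ℤ < total y → majAndMaj n (lookup (x ++ y)) ≡ Sign.+
  majAndMaj-positiveʳ 0<y
    rewrite MAJ-positive n (λ i → lookup (x ++ y) (n ↑ʳ i)) (subst (0ℤ <_) (sym right) 0<y)
    with MAJ n (λ i → lookup (x ++ y) (i ↑ˡ n))
  ... | Sign.+ = refl
  ... | Sign.- = refl

  majAndMaj-negative : total x < 0ℤ → total y < 0ℤ → majAndMaj n (lookup (x ++ y)) ≡ Sign.-
  majAndMaj-negative x<0 y<0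
    rewrite MAJ-negative n (λ i → lookup (x ++ y) (i ↑ˡ n)) (subst (_< 0ℤ) (sym left) x<0)
          | MAJ-negative n (λ i → lookup (x ++ y) (n ↑ʳ i)) (subst (_< 0ℤ) (sym right) y<0) = refl

-- Padding to an arbitrary number of variables

padding : ∀ e → Vec Sign e
padding zero          = []
padding (suc zero)    = Sign.+ ∷ []
padding (suc (suc e)) = Sign.+ ∷ Sign.- ∷ padding e

total-padding : ∀ e → total (padding e) ≡ 0ℤ ⊎ total (padding e) ≡ 1ℤ
total-padding zero       = inj₁ refl
total-padding (suc zero) = inj₂ refl
total-padding (suc (suc e)) with total-padding e
... | inj₁ eq rewrite eq = inj₁ refl
... | inj₂ eq rewrite eq = inj₂ refl

padded-positive : ∀ {a s} (x : Vec Sign a) e → total x ≡ + 4 * s → 0ℤ < s → 0ℤ < total (x ++ padding e)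
padded-positive {s = s} x e eq 0<s rewrite total-++ x (padding e) | eq =
  +-mono-<-≤ (0<* {+ 4} 0<+[ 3 ] 0<s) 0≤pad
  where
  0≤pad : 0ℤ ≤ total (padding e)
  0≤pad with total-padding e
  ... | inj₁ eq rewrite eq = +≤+ ℕ.z≤n
  ... | inj₂ eq rewrite eq = +≤+ ℕ.z≤n

-- The padding adds at most 1 ≤ s, which cannot outweigh -4s.
padded-negative : ∀ {a s} (x : Vec Sign a) e → total x ≡ + 4 * - s → 0ℤ < s → total (x ++ padding e) < 0ℤ
padded-negative {s = s} x e eq 0<s rewrite total-++ x (padding e) | eq =
  subst (_< 0ℤ) (lemma s (total (padding e))) (neg-mono-< 0<4s-pad)
  where
  lemma : ∀ s p → - (+ 3 * s + (s - p)) ≡ + 4 * - s + p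
  lemma = solve-∀
  pad≤s : total (padding e) ≤ s
  pad≤s with total-padding e
  ... | inj₁ eq rewrite eq = <⇒≤ 0<s
  ... | inj₂ eq rewrite eq = i<j⇒suc[i]≤j 0<s
  0<4s-pad : 0ℤ < + 3 * s + (s - total (padding e))
  0<4s-pad = +-mono-<-≤ (0<* {+ 3} 0<+[ 2 ] 0<s) (0≤difference pad≤s)

-- With L = 2H and l = H - s the total 2L - 4l becomes 4s, so `s` can run through the signed nodes.
PositiveOn-centred-side : ∀ {r} H (z : Vec (Fin r) (H ℕ.+ H)) s → - + H ≤ s → s ≤ + H →
  PositiveOn (side z (+ H - s)) (+ 4 * s)
PositiveOn-centred-side H z s -H≤s s≤H =
  subst₂ (λ l v → PositiveOn (side z l) v) +l≡ total≡ (PositiveOn-side z l l≤2H)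
  where
  l = ∣ + H - s ∣
  +l≡ : + l ≡ + H - s
  +l≡ = 0≤i⇒+∣i∣≡i (0≤difference s≤H)
  lemma : ∀ H s → H + H ≡ (H - s) + (s - - H)
  lemma = solve-∀
  l≤2H : l ℕ.≤ H ℕ.+ H
  l≤2H = drop‿+≤+ (subst (_≤ + (H ℕ.+ H)) (sym +l≡) (≤-from-difference _ (lemma (+ H) s) (0≤difference -H≤s)))
  lemma₂ : ∀ H s → + 2 * (H + H) - + 4 * (H - s) ≡ + 4 * s
  lemma₂ = solve-∀
  total≡ : + 2 * + (H ℕ.+ H) - + 4 * + l ≡ + 4 * s
  total≡ = trans (cong (λ u → + 2 * + (H ℕ.+ H) - + 4 * u) +l≡) (lemma₂ (+ H) s)

-- Degrees in the two variables

decide-all : ∀ {k} {P Q : Fin k → Set} → (∀ j → P j ⊎ Q j) → (∀ j → P j) ⊎ ∃ Q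
decide-all {zero}  f = inj₁ λ ()
decide-all {suc k} f with f zero | decide-all (f ∘ suc)
... | inj₂ q | _            = inj₂ (zero , q)
... | inj₁ p | inj₂ (j , q) = inj₂ (suc j , q)
... | inj₁ p | inj₁ ps      = inj₁ λ { zero → p ; (suc j) → ps j }

-- The sum of the two degrees is compared with `m`: a small sum bounds the degree in each variable
-- separately, and a large sum makes the product of the two weights large.
LowDegree HighDegree : ℕ → Degree → Degree → Set
LowDegree  m d₁ d₂ = d₁ ≡ nothing ⊎ d₂ ≡ nothing ⊎ ∃ λ a → ∃ λ b → d₁ ≡ just a × d₂ ≡ just b × a ℕ.+ b ℕ.≤ m
HighDegree m d₁ d₂ = ∃ λ a → ∃ λ b → d₁ ≡ just a × d₂ ≡ just b × m ℕ.< a ℕ.+ b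

low-or-high : ∀ m d₁ d₂ → LowDegree m d₁ d₂ ⊎ HighDegree m d₁ d₂
low-or-high m nothing  d₂       = inj₁ (inj₁ refl)
low-or-high m (just a) nothing  = inj₁ (inj₂ (inj₁ refl))
low-or-high m (just a) (just b) with (a ℕ.+ b) ℕ.≤? m
... | yes a+b≤m = inj₁ (inj₂ (inj₂ (a , b , refl , refl , a+b≤m)))
... | no  a+b≰m = inj₂ (a , b , refl , refl , ℕ.≰⇒> a+b≰m)

Poly-product : ∀ {m d₁ d₂ f g} c t →
  LowDegree m d₁ d₂ → PolyOf d₁ f → PolyOf d₂ g → Poly m (λ s → c * (f s * g t))
Poly-product {f = f} {g} c t (inj₁ refl) Pf Pg =
  constant 0ℤ λ s → trans (cong (λ u → c * (u * g t)) (Pf s)) (*-zeroʳ c)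
Poly-product {f = f} {g} c t (inj₂ (inj₁ refl)) Pf Pg =
  constant 0ℤ λ s → trans (cong (λ u → c * (f s * u)) (Pg t)) (trans (cong (c *_) (*-zeroʳ (f s))) (*-zeroʳ c))
Poly-product {f = f} {g} c t (inj₂ (inj₂ (a , b , refl , refl , a+b≤m))) Pf Pg =
  Poly-ext (λ s → lemma c (f s) (g t)) (Poly-scale (c * g t) (Poly-weaken (ℕ.≤-trans (ℕ.m≤m+n a b) a+b≤m) Pf))
  where
  lemma : ∀ c u v → c * (u * v) ≡ c * v * u
  lemma = solve-∀

LowDegree-sym : ∀ {m d₁ d₂} → LowDegree m d₁ d₂ → LowDegree m d₂ d₁
LowDegree-sym (inj₁ eq)        = inj₂ (inj₁ eq)
LowDegree-sym (inj₂ (inj₁ eq)) = inj₁ eq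
LowDegree-sym {m} (inj₂ (inj₂ (a , b , eq₁ , eq₂ , a+b≤m))) =
  inj₂ (inj₂ (b , a , eq₂ , eq₁ , subst (ℕ._≤ m) (ℕ.+-comm a b) a+b≤m))

PolyOf-∘-centre : ∀ d {f} h → PolyOf d f → PolyOf d (λ s → f (h - s))
PolyOf-∘-centre nothing  h f≗0 s = f≗0 _
PolyOf-∘-centre (just d) {f} h Pf = Poly-ext (λ s → cong f (lemma h s)) (Poly-∘-affine h -1ℤ Pf)
  where
  lemma : ∀ h s → h - s ≡ h + -1ℤ * s
  lemma = solve-∀

-- Sign representations of low density

-- There are `H + H` logical variables so that `s` ranges over -H, ..., H, and `suc r` pairs so that
-- every block has a pair to choose.
size : ℕ → ℕ → ℕ
size r H = (H ℕ.+ H) ℕ.* (suc r ℕ.* 2)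

module _ {r H k : ℕ} (C : Fin k → ℤ) (S₁ S₂ : Fin k → Vec Bool (size r H)) where

  bilinear : Vec Sign (size r H) → Vec Sign (size r H) → ℤ
  bilinear x y = sumℤ k (λ j → C j * (character (S₁ j) x * character (S₂ j) y))

  record SignPattern : Set where
    field
      positiveˡ : ∀ x y s → total x ≡ + 4 * s → 0ℤ < s → 0ℤ < bilinear x y
      positiveʳ : ∀ x y t → total y ≡ + 4 * t → 0ℤ < t → 0ℤ < bilinear x y
      negativeˡʳ : ∀ x y s t → total x ≡ + 4 * - s → 0ℤ < s → total y ≡ + 4 * - t → 0ℤ < t → bilinear x y < 0ℤ

  module _ (z₁ z₂ : Vec (Fin (suc r)) (H ℕ.+ H)) where

    average : (Vec Sign (size r H) → Vec Sign (size r H) → ℤ) → ℤ → ℤ → ℤ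
    average F s t = ∫ (side z₁ (+ H - s)) (λ x → ∫ (side z₂ (+ H - t)) (F x))

    -- Each term separates `x` from `y`, so its double average is a product of two one-variable
    -- averages, whose degrees `degree-correct` bounds.
    average-bilinear : ∀ s t → average bilinear s t ≡
      sumℤ k (λ j → C j * (∫ (side z₁ (+ H - s)) (character (S₁ j)) * ∫ (side z₂ (+ H - t)) (character (S₂ j))))
    average-bilinear s t = begin
      ∫ μ (λ x → ∫ ν (bilinear x))
        ≡⟨ ∫-cong μ (λ x → trans (∫-sumℤ ν k _) (sumℤ-cong k (inner x))) ⟩
      ∫ μ (λ x → sumℤ k (λ j → C j * ∫ ν (character (S₂ j)) * character (S₁ j) x))
        ≡⟨ ∫-sumℤ μ k (λ j x → C j * ∫ ν (character (S₂ j)) * character (S₁ j) x) ⟩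
      sumℤ k (λ j → ∫ μ (λ x → C j * ∫ ν (character (S₂ j)) * character (S₁ j) x))
        ≡⟨ sumℤ-cong k (λ j → trans (∫-* μ (C j * ∫ ν (character (S₂ j))) (character (S₁ j)))
                                    (lemma₂ (C j) (∫ ν (character (S₂ j))) (∫ μ (character (S₁ j))))) ⟩
      sumℤ k (λ j → C j * (∫ μ (character (S₁ j)) * ∫ ν (character (S₂ j)))) ∎
      where
      open ≡-Reasoning
      μ = side z₁ (+ H - s)
      ν = side z₂ (+ H - t)
      lemma₁ : ∀ c u v → c * (u * v) ≡ c * u * v
      lemma₁ = solve-∀
      lemma₂ : ∀ c u v → c * u * v ≡ c * (v * u)
      lemma₂ = solve-∀
      lemma₃ : ∀ c u v → c * u * v ≡ c * v * u
      lemma₃ = solve-∀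
      inner : ∀ x j → ∫ ν (λ y → C j * (character (S₁ j) x * character (S₂ j) y)) ≡
                      C j * ∫ ν (character (S₂ j)) * character (S₁ j) x
      inner x j = begin
        ∫ ν (λ y → C j * (character (S₁ j) x * character (S₂ j) y))
          ≡⟨ ∫-cong ν (λ y → lemma₁ (C j) (character (S₁ j) x) (character (S₂ j) y)) ⟩
        ∫ ν (λ y → C j * character (S₁ j) x * character (S₂ j) y)
          ≡⟨ ∫-* ν (C j * character (S₁ j) x) (character (S₂ j)) ⟩
        C j * character (S₁ j) x * ∫ ν (character (S₂ j))
          ≡⟨ lemma₃ (C j) (character (S₁ j) x) (∫ ν (character (S₂ j))) ⟩
        C j * ∫ ν (character (S₂ j)) * character (S₁ j) x ∎

    average-positive : ∀ {s t} F → - + H ≤ s → s ≤ + H → - + H ≤ t → t ≤ + H →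
      (∀ x y → total x ≡ + 4 * s → total y ≡ + 4 * t → 0ℤ < F x y) → 0ℤ < average F s t
    average-positive {s} {t} F -H≤s s≤H -H≤t t≤H 0<F =
      PositiveOn-centred-side H z₁ s -H≤s s≤H (λ x → ∫ (side z₂ (+ H - t)) (F x)) λ x tx →
      PositiveOn-centred-side H z₂ t -H≤t t≤H (F x) λ y ty → 0<F x y tx ty

    average-neg : ∀ F s t → average (λ x y → -1ℤ * F x y) s t ≡ - average F s t
    average-neg F s t =
      trans (∫-cong (side z₁ (+ H - s)) λ x → ∫-* (side z₂ (+ H - t)) -1ℤ (F x))
     (trans (∫-* (side z₁ (+ H - s)) -1ℤ (λ x → ∫ (side z₂ (+ H - t)) (F x))) (-1*i≡-i (average F s t)))

    -- Since q^m = H, all the nodes ±qⁱ with i ≤ m lie in [-H, H], where the averaging measures are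
    -- positive; low degrees would then give the polynomial excluded by
    -- `no-bivariate-sign-representation`.
    not-all-low : ∀ {m} → q ^ m ≡ + H → SignPattern →
      ¬ (∀ j → LowDegree m (degree z₁ (S₁ j)) (degree z₂ (S₂ j)))
    not-all-low {m} q^m≡H pattern-p low = no-bivariate-sign-representation {m} (average bilinear)
      (λ t → Poly-ext (λ s → average-bilinear s t)
        (Poly-sumℤ k (λ j s → C j * (f j s * g j t)) λ j →
          Poly-product {f = f j} {g = g j} (C j) t (low j) (Pf j) (Pg j)))
      (λ s → Poly-ext (λ t → trans (average-bilinear s t)
          (sumℤ-cong k λ j → cong (C j *_) (*-comm (f j s) (g j t))))
        (Poly-sumℤ k (λ j t → C j * (g j t * f j s)) λ j →
          Poly-product {f = g j} {g = f j} (C j) s (LowDegree-sym (low j)) (Pg j) (Pf j)))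
      (λ i j i≤m j≤m → average-positive bilinear (-H≤+ i) (+≤H i≤m) (-H≤+ j) (+≤H j≤m) λ x y tx ty →
        positiveˡ x y (q ^ i) tx (0<q^ i))
      (λ i j i≤m j≤m → average-positive bilinear (-H≤+ i) (+≤H i≤m) (-H≤- j≤m) (-≤H j) λ x y tx ty →
        positiveˡ x y (q ^ i) tx (0<q^ i))
      (λ i j i≤m j≤m → average-positive bilinear (-H≤- i≤m) (-≤H i) (-H≤+ j) (+≤H j≤m) λ x y tx ty →
        positiveʳ x y (q ^ j) ty (0<q^ j))
      -- `PositiveOn` transports positivity only, so the negative quadrant is treated through
      -- -`bilinear`.
      (λ i j i≤m j≤m → neg-cancel-< (subst (0ℤ <_) (average-neg bilinear (- (q ^ i)) (- (q ^ j)))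
        (average-positive (λ x y → -1ℤ * bilinear x y) (-H≤- i≤m) (-≤H i) (-H≤- j≤m) (-≤H j) λ x y tx ty →
          subst (0ℤ <_) (sym (-1*i≡-i (bilinear x y)))
            (neg-mono-< (negativeˡʳ x y (q ^ i) (q ^ j) tx (0<q^ i) ty (0<q^ j))))))
      where
      open SignPattern pattern-p
      f g : Fin k → ℤ → ℤ
      f j s = ∫ (side z₁ (+ H - s)) (character (S₁ j))
      g j t = ∫ (side z₂ (+ H - t)) (character (S₂ j))
      Pf : ∀ j → PolyOf (degree z₁ (S₁ j)) (f j)
      Pf j = PolyOf-∘-centre (degree z₁ (S₁ j)) (+ H) (degree-correct z₁ (S₁ j))
      Pg : ∀ j → PolyOf (degree z₂ (S₂ j)) (g j)
      Pg j = PolyOf-∘-centre (degree z₂ (S₂ j)) (+ H) (degree-correct z₂ (S₂ j))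
      +≤H : ∀ {i} → i ℕ.≤ m → q ^ i ≤ + H
      +≤H {i} i≤m = subst (q ^ i ≤_) q^m≡H (q^-mono i≤m)
      -H≤+ : ∀ i → - + H ≤ q ^ i
      -H≤+ i = 0≤⇒-≤ (+≤+ ℕ.z≤n) (<⇒≤ (0<q^ i))
      -≤H : ∀ i → - (q ^ i) ≤ + H
      -≤H i = 0≤⇒-≤ (<⇒≤ (0<q^ i)) (+≤+ ℕ.z≤n)
      -H≤- : ∀ {i} → i ℕ.≤ m → - + H ≤ - (q ^ i)
      -H≤- i≤m = neg-mono-≤ (+≤H i≤m)

  high-degree-weight : ∀ {m} (z₁ z₂ : Vec (Fin (suc r)) (H ℕ.+ H)) {j} →
    HighDegree m (degree z₁ (S₁ j)) (degree z₂ (S₂ j)) →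
    suc r ℕ.^ suc m ℕ.≤ degree-weight (suc r) (degree z₁ (S₁ j)) ℕ.* degree-weight (suc r) (degree z₂ (S₂ j))
  high-degree-weight {m} z₁ z₂ (a , b , eq₁ , eq₂ , m<a+b) = begin
    suc r ℕ.^ suc m              ≤⟨ ℕ.^-monoʳ-≤ (suc r) m<a+b ⟩
    suc r ℕ.^ (a ℕ.+ b)          ≡⟨ ℕ.^-distribˡ-+-* (suc r) a b ⟩
    suc r ℕ.^ a ℕ.* suc r ℕ.^ b  ≡⟨ cong₂ (λ u v → degree-weight (suc r) u ℕ.* degree-weight (suc r) v) eq₁ eq₂ ⟨
    degree-weight (suc r) (degree z₁ (S₁ _)) ℕ.* degree-weight (suc r) (degree z₂ (S₂ _)) ∎
    where open ℕ.≤-Reasoning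

  bilinear-density : ∀ {m} → q ^ m ≡ + H → SignPattern → suc r ℕ.^ suc m ℕ.≤ k
  bilinear-density {m} q^m≡H pattern-p =
    [ (λ low → ⊥-elim (not-all-low z₁ z₂ q^m≡H pattern-p low))
    , (λ (j , high) → begin
        suc r ℕ.^ suc m       ≤⟨ high-degree-weight z₁ z₂ {j} high ⟩
        w₁ j ℕ.* w₂ j         ≡⟨ cong (ℕ._* w₂ j) (ℕ.*-identityˡ (w₁ j)) ⟨
        1 ℕ.* w₁ j ℕ.* w₂ j   ≤⟨ term≤sum (λ j → 1 ℕ.* w₁ j ℕ.* w₂ j) j ⟩
        sum (λ j → 1 ℕ.* w₁ j ℕ.* w₂ j)  ≤⟨ proj₂ second ⟩
        sum (λ j → 1 ℕ.* w₁ j)           ≤⟨ proj₂ first ⟩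
        sum {k} (λ _ → 1)     ≡⟨ sum-one k ⟩
        k                     ∎)
    ]′ (decide-all λ j → low-or-high m (degree z₁ (S₁ j)) (degree z₂ (S₂ j)))
    where
    open ℕ.≤-Reasoning
    first = choose-live-pairs r (H ℕ.+ H) S₁ (λ _ → 1)
    z₁ = proj₁ first
    w₁ : Fin k → ℕ
    w₁ j = degree-weight (suc r) (degree z₁ (S₁ j))
    -- The weights of the first side enter as coefficients, so that Σ w₁ w₂ ≤ Σ w₁ ≤ k.
    second = choose-live-pairs r (H ℕ.+ H) S₂ (λ j → 1 ℕ.* w₁ j)
    z₂ = proj₁ second
    w₂ : Fin k → ℕ
    w₂ j = degree-weight (suc r) (degree z₂ (S₂ j))
    sum-one : ∀ k → sum {k} (λ _ → 1) ≡ k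
    sum-one zero    = refl
    sum-one (suc k) = cong suc (sum-one k)

-- From threshold representations to bilinear forms

character-take-drop : ∀ a {b} (S : Vec Bool (a ℕ.+ b)) x y →
  character S (x ++ y) ≡ character (take a S) x * character (drop a S) y
character-take-drop a S x y =
  trans (cong (λ S → character S (x ++ y)) (sym (take++drop≡id a S))) (character-++ (take a S) (drop a S) x y)

character-padded : ∀ M e (S : Vec Bool ((M ℕ.+ e) ℕ.+ (M ℕ.+ e))) x p y p' →
  character S ((x ++ p) ++ (y ++ p')) ≡
  character (take M (take (M ℕ.+ e) S)) x * character (drop M (take (M ℕ.+ e) S)) p *
  (character (take M (drop (M ℕ.+ e) S)) y * character (drop M (drop (M ℕ.+ e) S)) p')
character-padded M e S x p y p' =
  trans (character-take-drop (M ℕ.+ e) S (x ++ p) (y ++ p'))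
        (cong₂ _*_ (character-take-drop M (take (M ℕ.+ e) S) x p) (character-take-drop M (drop (M ℕ.+ e) S) y p'))

density-bound : ∀ r H e m k → q ^ m ≡ + H →
  HasThresholdRep (majAndMaj (size r H ℕ.+ e)) k → suc r ℕ.^ suc m ℕ.≤ k
density-bound r H e m k q^m≡H (S , λs , represents) = bilinear-density {r} {H} {k} C S₁ S₂ {m} q^m≡H record
  { positiveˡ = λ x y s tx 0<s → bilinear-positive x y
      (majAndMaj-positiveˡ (x ++ pad) (y ++ pad) (padded-positive x e tx 0<s))
  ; positiveʳ = λ x y t ty 0<t → bilinear-positive x y
      (majAndMaj-positiveʳ (x ++ pad) (y ++ pad) (padded-positive y e ty 0<t))
  ; negativeˡʳ = λ x y s t tx 0<s ty 0<t →
      subst (_< 0ℤ) (value x y) (numerator-<0 (proj₂ (proj₂ cleared) (monomials x y))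
        (proj₂ (represents (lookup (point x y)))
          (majAndMaj-negative (x ++ pad) (y ++ pad) (padded-negative x e tx 0<s) (padded-negative y e ty 0<t))))
  }
  where
  M = size r H
  pad = padding e
  cleared = clear-denominators k λs
  c = proj₁ cleared
  S₁ S₂ : Fin k → Vec Bool M
  S₁ j = take M (take (M ℕ.+ e) (S j))
  S₂ j = take M (drop (M ℕ.+ e) (S j))
  e₁ e₂ C : Fin k → ℤ
  e₁ j = character (drop M (take (M ℕ.+ e) (S j))) pad
  e₂ j = character (drop M (drop (M ℕ.+ e) (S j))) pad
  -- The padding coordinates are constants, so their characters `e₁ j` and `e₂ j` go into the
  -- coefficient.
  C j = c j * (e₁ j * e₂ j)
  point : Vec Sign M → Vec Sign M → Vec Sign ((M ℕ.+ e) ℕ.+ (M ℕ.+ e))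
  point x y = (x ++ pad) ++ (y ++ pad)
  monomials : Vec Sign M → Vec Sign M → Fin k → Sign
  monomials x y j = monomial (S j) (lookup (point x y))
  lemma : ∀ c a b u v → c * (u * a * (v * b)) ≡ c * (a * b) * (u * v)
  lemma = solve-∀
  value : ∀ x y → sumℤ k (λ j → c j * signℤ (monomials x y j)) ≡ bilinear {r} {H} C S₁ S₂ x y
  value x y = sumℤ-cong k λ j →
    trans (cong (c j *_) (trans (monomial-lookup (S j) (point x y)) (character-padded M e (S j) x pad y pad)))
          (lemma (c j) (e₁ j) (e₂ j) (character (S₁ j) x) (character (S₂ j) y))
  bilinear-positive : ∀ x y → majAndMaj (M ℕ.+ e) (lookup (point x y)) ≡ Sign.+ →
    0ℤ < bilinear {r} {H} C S₁ S₂ x y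
  bilinear-positive x y eq = subst (0ℤ <_) (value x y)
    (0<-numerator (proj₂ (proj₂ cleared) (monomials x y)) (proj₁ (represents (lookup (point x y))) eq))

-- Choice of parameters

-- Quantifying over the accessibility proof lets the induction follow the recursion of `⌊log2⌋`
-- itself.
2^⌊log2⌋≤ : ∀ n (a : Acc ℕ._<_ (suc n)) → 2 ℕ.^ ⌊log2⌋ (suc n) a ℕ.≤ suc n
2^⌊log2⌋≤ zero    _        = ℕ.≤-refl
2^⌊log2⌋≤ (suc n) (acc rs) = begin
  2 ℕ.* 2 ℕ.^ ⌊log2⌋ (suc ℕ.⌊ n /2⌋) _  ≤⟨ ℕ.*-monoʳ-≤ 2 (2^⌊log2⌋≤ ℕ.⌊ n /2⌋ _) ⟩
  2 ℕ.* suc ℕ.⌊ n /2⌋                   ≡⟨ lemma ℕ.⌊ n /2⌋ ⟩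
  2 ℕ.+ (ℕ.⌊ n /2⌋ ℕ.+ ℕ.⌊ n /2⌋)       ≤⟨ ℕ.+-monoʳ-≤ 2 (ℕ.+-monoʳ-≤ ℕ.⌊ n /2⌋ (ℕ.⌊n/2⌋≤⌈n/2⌉ n)) ⟩
  2 ℕ.+ (ℕ.⌊ n /2⌋ ℕ.+ ℕ.⌈ n /2⌉)       ≡⟨ cong (2 ℕ.+_) (ℕ.⌊n/2⌋+⌈n/2⌉≡n n) ⟩
  2 ℕ.+ n                               ∎
  where
  open ℕ.≤-Reasoning
  lemma : ∀ h → 2 ℕ.* suc h ≡ 2 ℕ.+ (h ℕ.+ h)
  lemma = ℕ-RingSolver.solve-∀

2^⌊log₂n⌋≤n : ∀ n → 1 ℕ.≤ n → 2 ℕ.^ ⌊log₂ n ⌋ ℕ.≤ n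
2^⌊log₂n⌋≤n (suc n) _ = 2^⌊log2⌋≤ n _

n<2^[1+⌊log₂n⌋] : ∀ n → n ℕ.< 2 ℕ.^ suc ⌊log₂ n ⌋
n<2^[1+⌊log₂n⌋] n = ℕ.≰⇒> λ 2^≤n →
  ℕ.1+n≰n (subst (ℕ._≤ ⌊log₂ n ⌋) (⌊log₂[2^n]⌋≡n (suc ⌊log₂ n ⌋)) (⌊log₂⌋-mono-≤ 2^≤n))

q^≡ : ∀ m → q ^ m ≡ + (1024 ℕ.^ m)
q^≡ zero    = refl
q^≡ (suc m) = trans (cong₂ _*_ q≡1024 (q^≡ m)) (sym (pos-* 1024 (1024 ℕ.^ m)))

module Parameters (n : ℕ) (4096≤n : 4096 ℕ.≤ n) where
  b t ρ m : ℕ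
  -- The block size 2^ρ is n^(1/4) up to a constant factor, and H = 2^(10m) = 2^(40t) is at most the
  -- square root of n, which leaves room for the 4 H 2^ρ variables. Taking m = 4t offsets the fourth
  -- root: (2^ρ)^m ≥ n^t.
  b = ⌊log₂ n ⌋
  t = b ℕ./ 80
  ρ = suc (b ℕ./ 4)
  m = 4 ℕ.* t

  -- The source of 4096 = 2^12: `exponent-bound` multiplies its three additive units by 4 and
  -- absorbs the resulting 12 into `b`.
  12≤b : 12 ℕ.≤ b
  12≤b = ℕ.≮⇒≥ λ b<12 → ℕ.<⇒≱ (n<2^[1+⌊log₂n⌋] n) (ℕ.≤-trans (ℕ.^-monoʳ-≤ 2 b<12) 4096≤n)

  1+b≤4ρ : suc b ℕ.≤ 4 ℕ.* ρ
  1+b≤4ρ = begin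
    suc b                              ≡⟨ cong suc (m≡m%n+[m/n]*n b 4) ⟩
    suc (b ℕ.% 4) ℕ.+ b ℕ./ 4 ℕ.* 4    ≤⟨ ℕ.+-monoˡ-≤ (b ℕ./ 4 ℕ.* 4) (m%n<n b 4) ⟩
    4 ℕ.+ b ℕ./ 4 ℕ.* 4                ≡⟨ ℕ.*-comm ρ 4 ⟩
    4 ℕ.* ρ                            ∎
    where open ℕ.≤-Reasoning

  exponent-bound : suc (10 ℕ.* m) ℕ.+ suc ρ ℕ.≤ b
  exponent-bound = ℕ.*-cancelˡ-≤ 4 (begin
    4 ℕ.* (suc (10 ℕ.* (4 ℕ.* t)) ℕ.+ suc ρ)            ≡⟨ lemma₁ t (b ℕ./ 4) ⟩
    2 ℕ.* (t ℕ.* 80) ℕ.+ (b ℕ./ 4 ℕ.* 4 ℕ.+ 12)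
      ≤⟨ ℕ.+-mono-≤ (ℕ.*-monoʳ-≤ 2 (m/n*n≤m b 80)) (ℕ.+-mono-≤ (m/n*n≤m b 4) 12≤b) ⟩
    2 ℕ.* b ℕ.+ (b ℕ.+ b)                               ≡⟨ lemma₂ b ⟩
    4 ℕ.* b                                             ∎)
    where
    open ℕ.≤-Reasoning
    lemma₁ : ∀ t c → 4 ℕ.* (suc (10 ℕ.* (4 ℕ.* t)) ℕ.+ suc (suc c)) ≡ 2 ℕ.* (t ℕ.* 80) ℕ.+ (c ℕ.* 4 ℕ.+ 12)
    lemma₁ = ℕ-RingSolver.solve-∀
    lemma₂ : ∀ b → 2 ℕ.* b ℕ.+ (b ℕ.+ b) ≡ 4 ℕ.* b
    lemma₂ = ℕ-RingSolver.solve-∀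

  r : ℕ
  r = ℕ.pred (2 ℕ.^ ρ)

  1+r≡2^ρ : suc r ≡ 2 ℕ.^ ρ
  1+r≡2^ρ = ℕ.suc-pred (2 ℕ.^ ρ) {{ℕ.m^n≢0 2 ρ}}

  H : ℕ
  H = 1024 ℕ.^ m

  size≤n : size r H ℕ.≤ n
  size≤n = begin
    (H ℕ.+ H) ℕ.* (suc r ℕ.* 2)
      ≡⟨ cong₂ (λ u v → (u ℕ.+ u) ℕ.* (v ℕ.* 2)) (ℕ.^-*-assoc 2 10 m) 1+r≡2^ρ ⟩
    (2 ℕ.^ (10 ℕ.* m) ℕ.+ 2 ℕ.^ (10 ℕ.* m)) ℕ.* (2 ℕ.^ ρ ℕ.* 2)
                                             ≡⟨ lemma (2 ℕ.^ (10 ℕ.* m)) (2 ℕ.^ ρ) ⟩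
    2 ℕ.^ suc (10 ℕ.* m) ℕ.* 2 ℕ.^ suc ρ     ≡⟨ ℕ.^-distribˡ-+-* 2 (suc (10 ℕ.* m)) (suc ρ) ⟨
    2 ℕ.^ (suc (10 ℕ.* m) ℕ.+ suc ρ)         ≤⟨ ℕ.^-monoʳ-≤ 2 exponent-bound ⟩
    2 ℕ.^ b                                  ≤⟨ 2^⌊log₂n⌋≤n n (ℕ.≤-trans (ℕ.s≤s ℕ.z≤n) 4096≤n) ⟩
    n                                        ∎
    where
    open ℕ.≤-Reasoning
    lemma : ∀ u v → (u ℕ.+ u) ℕ.* (v ℕ.* 2) ≡ (2 ℕ.* u) ℕ.* (2 ℕ.* v)
    lemma = ℕ-RingSolver.solve-∀

  n^t≤ : n ℕ.^ t ℕ.≤ suc r ℕ.^ suc m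
  n^t≤ = begin
    n ℕ.^ t                   ≤⟨ ℕ.^-monoˡ-≤ t (ℕ.<⇒≤ (n<2^[1+⌊log₂n⌋] n)) ⟩
    (2 ℕ.^ suc b) ℕ.^ t       ≡⟨ ℕ.^-*-assoc 2 (suc b) t ⟩
    2 ℕ.^ (suc b ℕ.* t)       ≤⟨ ℕ.^-monoʳ-≤ 2 (ℕ.*-monoˡ-≤ t 1+b≤4ρ) ⟩
    2 ℕ.^ (4 ℕ.* ρ ℕ.* t)     ≡⟨ cong (2 ℕ.^_) (lemma ρ t) ⟩
    2 ℕ.^ (ρ ℕ.* (4 ℕ.* t))   ≤⟨ ℕ.^-monoʳ-≤ 2 (ℕ.*-monoʳ-≤ ρ (ℕ.n≤1+n m)) ⟩
    2 ℕ.^ (ρ ℕ.* suc m)       ≡⟨ ℕ.^-*-assoc 2 ρ (suc m) ⟨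
    (2 ℕ.^ ρ) ℕ.^ suc m       ≡⟨ cong (ℕ._^ suc m) 1+r≡2^ρ ⟨
    suc r ℕ.^ suc m           ∎
    where
    open ℕ.≤-Reasoning
    lemma : ∀ ρ t → 4 ℕ.* ρ ℕ.* t ≡ ρ ℕ.* (4 ℕ.* t)
    lemma = ℕ-RingSolver.solve-∀

theorem6p4 : Σ ℕ λ a → Σ ℕ λ N →
    ∀ n → N ℕ.≤ n → ∀ k → HasThresholdRep (majAndMaj n) k →
    n ℕ.^ (⌊log₂ n ⌋ ℕ./ suc a) ℕ.≤ k
-- `suc 79` is the divisor 80 in `t`; the n - `size r H` remaining variables of each majority become
-- padding.
theorem6p4 = 79 , 4096 , λ n 4096≤n k rep →
  let open Parameters n 4096≤n in
  ℕ.≤-trans n^t≤ (density-bound r H (n ℕ.∸ size r H) m k (q^≡ m)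
    (subst (λ n → HasThresholdRep (majAndMaj n) k) (sym (ℕ.m+[n∸m]≡n size≤n)) rep))
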